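{- Let $G^*$ be a hypergraph of order $n$ with adjacency matrix $A$ and Seidel matrix $S$, and let $P_A(\lambda)=\det(\lambda I_n-A)$ and $P_S(\lambda)=\det(\lambda I_n-S)$ be their characteristic polynomials. Let $H_{G^*}$ be the walk generating function of $G^*$. Then $$P_S(\lambda)=(-2)^n\,P_A\!\left(-\frac{\lambda+1}{2}\right)\left(\frac{ -1}{\lambda+1}\,H_{G^*}\!\left(\frac{ -2}{\lambda+1}\right)+1\right).$$
   Context: A hypergraph $G^*=(V,E)$ of order $n$ has a finite vertex set $V=\{v_1,\dots,v_n\}$ and a finite set $E=\{e_1,\dots,e_m\}$ of hyperedges, each a subset of $V$. Its adjacency matrix $A=(a_{ij})$ is the $n\times n$ matrix with $a_{ij}=|\{e\in E:\{v_i,v_j\}\subset e\}|$ for $i\ne j$ and $a_{ii}=0$. Its Seidel matrix is $S=J_n-I_n-2A$, where $J_n$ is the all-ones matrix and $I_n$ the identity matrix of order $n$. A walk of length $l$ is a sequence $w_0,f_1,w_1,\dots,f_l,w_l$ with $w_i\in V$, $f_i\in E$, $w_{i-1}\neq w_i$ and $w_{i-1},w_i\in f_i$; $N_l$ denotes the total number of walks of length $l$ in $G^*$ (equivalently, the sum of all entries of $A^l$). The walk generating function is $H_{G^*}(t)=\sum_{l=0}^{\infty}N_l t^l$; this series converges for $|t|$ small and there equals a rational function of $t$, also denoted $H_{G^*}(t)$. The identity is understood as an identity of rational functions in $\lambda$ (equivalently, for all real $\lambda$ with $|\lambda+1|$ sufficiently large). -}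

module Defs where

open import Algebra.Bundles.Raw using (RawRing)
import Algebra.Definitions.RawMonoid as RawMonoidDefs
import Algebra.Definitions.RawSemiring as RawSemiringDefs
open import Data.Bool.Base using (if_then_else_)
open import Data.Fin.Base as Fin using (Fin; toℕ; punchIn)
import Data.Fin.Properties as Fin
open import Data.Fin.Subset using (Subset; _∈_; _∪_; ⁅_⁆; _⊆_)
open import Data.Fin.Subset.Properties using (_∈?_; _⊆?_)
open import Data.Integer.Base as ℤ using (ℤ; 0ℤ; 1ℤ; -1ℤ; +_; _+_; _*_; _-_)
import Data.Integer.Properties as ℤ
open import Data.List.Base
  using (List; []; _∷_; length; filter; map; allFin; cartesianProduct; cartesianProductWith)
open import Data.List.Relation.Unary.Unique.Propositional using (Unique)
open import Data.Nat.Base using (ℕ; zero; suc; _∸_)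
open import Data.Product.Base using (_×_; _,_; proj₁; proj₂)
open import Data.Sum.Base using (_⊎_; inj₁; inj₂; [_,_]′)
open import Data.Unit.Base using (⊤; tt)
open import Data.Vec.Base as Vec using (Vec)
open import Level using (0ℓ)
open import Relation.Binary.PropositionalEquality
  using (_≡_; _≢_; refl; sym; trans; cong; cong₂)
open import Relation.Nullary using (¬_; Dec; yes; no; does)
open import Relation.Nullary.Decidable using (_×-dec_; ¬?)

------------------------------------------------------------------------
-- Matrices and determinants

Matrix : Set → ℕ → Set
Matrix A n = Fin n → Fin n → A

module Det (R : RawRing 0ℓ 0ℓ) where
  open RawRing R using (Carrier; rawSemiring; +-rawMonoid; 0#; 1#; -_)
    renaming (_*_ to _·_)
  open RawMonoidDefs +-rawMonoid public using (sum)
  open RawSemiringDefs rawSemiring using (_^_)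

  -- Laplace expansion along the first row; the minor is obtained by deleting
  -- row zero and column j.
  det : ∀ {n} → Matrix Carrier n → Carrier
  det {zero}  M = 1#
  det {suc n} M = sum λ j →
    ((- 1#) ^ toℕ j) · (M Fin.zero j · det (λ i k → M (Fin.suc i) (punchIn j k)))

  identity : ∀ n → Matrix Carrier n
  identity n i j = if does (i Fin.≟ j) then 1# else 0#

------------------------------------------------------------------------
-- Polynomials over ℤ

-- Coefficient lists, constant term first. Trailing zeros are allowed, so
-- equality is _≈ᴾ_ rather than _≡_.
Poly : Set
Poly = List ℤ

coeff : Poly → ℕ → ℤ
coeff []      _       = 0ℤ
coeff (a ∷ _) zero    = a
coeff (_ ∷ p) (suc k) = coeff p k

infix 4 _≈ᴾ_
_≈ᴾ_ : Poly → Poly → Set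
p ≈ᴾ q = ∀ k → coeff p k ≡ coeff q k

constᴾ : ℤ → Poly
constᴾ a = a ∷ []

0ᴾ 1ᴾ Xᴾ : Poly
0ᴾ = []
1ᴾ = constᴾ 1ℤ
Xᴾ = 0ℤ ∷ 1ℤ ∷ []

infixl 6 _+ᴾ_
infixl 7 _*ᴾ_ _·ᴾ_
infix  8 -ᴾ_

_+ᴾ_ : Poly → Poly → Poly
[]      +ᴾ q       = q
(a ∷ p) +ᴾ []      = a ∷ p
(a ∷ p) +ᴾ (b ∷ q) = (a + b) ∷ (p +ᴾ q)

_·ᴾ_ : ℤ → Poly → Poly
a ·ᴾ p = map (a *_) p

-ᴾ_ : Poly → Poly
-ᴾ p = map ℤ.-_ p

_*ᴾ_ : Poly → Poly → Poly
[]      *ᴾ q = []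
(a ∷ p) *ᴾ q = (a ·ᴾ q) +ᴾ (0ℤ ∷ (p *ᴾ q))

polyRawRing : RawRing 0ℓ 0ℓ
polyRawRing = record
  { Carrier = Poly
  ; _≈_     = _≈ᴾ_
  ; _+_     = _+ᴾ_
  ; _*_     = _*ᴾ_
  ; -_      = -ᴾ_
  ; 0#      = 0ᴾ
  ; 1#      = 1ᴾ
  }

charPoly : ∀ {n} → Matrix ℤ n → Poly
charPoly {n} M = det λ i j → (Xᴾ *ᴾ identity n i j) +ᴾ (-ᴾ constᴾ (M i j))
  where open Det polyRawRing

------------------------------------------------------------------------
-- ℤ[X] has no zero divisors (needed to multiply denominators)

coeff-+ : ∀ p q k → coeff (p +ᴾ q) k ≡ coeff p k + coeff q k
coeff-+ []      q       k       = sym (ℤ.+-identityˡ _)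
coeff-+ (a ∷ p) []      k       = sym (ℤ.+-identityʳ _)
coeff-+ (a ∷ p) (b ∷ q) zero    = refl
coeff-+ (a ∷ p) (b ∷ q) (suc k) = coeff-+ p q k

coeff-· : ∀ a p k → coeff (a ·ᴾ p) k ≡ a * coeff p k
coeff-· a []      k       = sym (ℤ.*-zeroʳ a)
coeff-· a (b ∷ p) zero    = refl
coeff-· a (b ∷ p) (suc k) = coeff-· a p k

coeff-* : ∀ a p q k →
  coeff ((a ∷ p) *ᴾ q) k ≡ a * coeff q k + coeff (0ℤ ∷ (p *ᴾ q)) k
coeff-* a p q k = trans (coeff-+ (a ·ᴾ q) _ k) (cong (_+ _) (coeff-· a q k))

coeff-*-zero : ∀ p b q → b ≡ 0ℤ → coeff (p *ᴾ (b ∷ q)) zero ≡ 0ℤ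
coeff-*-zero []      b q _    = refl
coeff-*-zero (a ∷ p) b q refl =
  trans (coeff-* a p (0ℤ ∷ q) zero) (trans (ℤ.+-identityʳ _) (ℤ.*-zeroʳ a))

coeff-*-shift : ∀ p b q → b ≡ 0ℤ → ∀ k →
  coeff (p *ᴾ (b ∷ q)) (suc k) ≡ coeff (p *ᴾ q) k
coeff-*-shift []      b q b≡0 k = refl
coeff-*-shift (a ∷ p) b q b≡0 k =
  trans (coeff-* a p (b ∷ q) (suc k))
    (trans (cong (λ x → a * coeff q k + x) (tail k)) (sym (coeff-* a p q k)))
  where
  tail : ∀ k → coeff (p *ᴾ (b ∷ q)) k ≡ coeff (0ℤ ∷ (p *ᴾ q)) k
  tail zero    = coeff-*-zero p b q b≡0
  tail (suc k) = coeff-*-shift p b q b≡0 k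

zero-tail : ∀ {a p} → a ≡ 0ℤ → p ≈ᴾ 0ᴾ → (a ∷ p) ≈ᴾ 0ᴾ
zero-tail a≡0 p≈0 zero    = a≡0
zero-tail a≡0 p≈0 (suc k) = p≈0 k

*-cancel-unit : ∀ a p q → a ≢ 0ℤ → (a ∷ p) *ᴾ q ≈ᴾ 0ᴾ → q ≈ᴾ 0ᴾ
*-cancel-unit a p []      a≢0 eq = λ _ → refl
*-cancel-unit a p (b ∷ q) a≢0 eq =
  zero-tail b≡0 (*-cancel-unit a p q a≢0
    (λ k → trans (sym (coeff-*-shift (a ∷ p) b q b≡0 k)) (eq (suc k))))
  where
  ab≡0 : a * b ≡ 0ℤ
  ab≡0 = trans (sym (ℤ.+-identityʳ _))
               (trans (sym (coeff-* a p (b ∷ q) zero)) (eq zero))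
  b≡0 : b ≡ 0ℤ
  b≡0 with ℤ.i*j≡0⇒i≡0∨j≡0 a ab≡0
  ... | inj₁ a≡0 with () ← a≢0 a≡0
  ... | inj₂ b≡0 = b≡0

noZeroDivisorsᴾ : ∀ p q → p *ᴾ q ≈ᴾ 0ᴾ → p ≈ᴾ 0ᴾ ⊎ q ≈ᴾ 0ᴾ
noZeroDivisorsᴾ []      q eq = inj₁ (λ _ → refl)
noZeroDivisorsᴾ (a ∷ p) q eq with a ℤ.≟ 0ℤ
... | no  a≢0  = inj₂ (*-cancel-unit a p q a≢0 eq)
... | yes refl =
  [ (λ p≈0 → inj₁ (zero-tail refl p≈0)) , inj₂ ]′ (noZeroDivisorsᴾ p q pq≈0)
  where
  pq≈0 : p *ᴾ q ≈ᴾ 0ᴾ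
  pq≈0 k = trans (sym (trans (coeff-* 0ℤ p q (suc k)) (ℤ.+-identityˡ _))) (eq (suc k))

*ᴾ-nonzero : ∀ p q → ¬ p ≈ᴾ 0ᴾ → ¬ q ≈ᴾ 0ᴾ → ¬ p *ᴾ q ≈ᴾ 0ᴾ
*ᴾ-nonzero p q p≉0 q≉0 eq = [ p≉0 , q≉0 ]′ (noZeroDivisorsᴾ p q eq)

1ᴾ-nonzero : ¬ 1ᴾ ≈ᴾ 0ᴾ
1ᴾ-nonzero eq with () ← eq zero

------------------------------------------------------------------------
-- Rational functions: ℚ(X) as the field of fractions of ℤ[X]

record RatFun : Set where
  constructor _/ᴾ_⟨_⟩
  field
    num   : Poly
    den   : Poly
    den≉0 : ¬ den ≈ᴾ 0ᴾ

open RatFun public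

infix 4 _≈_
_≈_ : RatFun → RatFun → Set
f ≈ g = num f *ᴾ den g ≈ᴾ num g *ᴾ den f

fromPoly : Poly → RatFun
fromPoly p = p /ᴾ 1ᴾ ⟨ 1ᴾ-nonzero ⟩

const : ℤ → RatFun
const a = fromPoly (constᴾ a)

0ᴿ 1ᴿ : RatFun
0ᴿ = fromPoly 0ᴾ
1ᴿ = const 1ℤ

infixl 6 _+ᴿ_
infixl 7 _*ᴿ_

_+ᴿ_ : RatFun → RatFun → RatFun
f +ᴿ g = (num f *ᴾ den g +ᴾ num g *ᴾ den f) /ᴾ (den f *ᴾ den g)
  ⟨ *ᴾ-nonzero (den f) (den g) (den≉0 f) (den≉0 g) ⟩

_*ᴿ_ : RatFun → RatFun → RatFun
f *ᴿ g = (num f *ᴾ num g) /ᴾ (den f *ᴾ den g) ⟨ *ᴾ-nonzero (den f) (den g) (den≉0 f) (den≉0 g) ⟩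

num-nonzero : ∀ f → ¬ f ≈ 0ᴿ → ¬ num f ≈ᴾ 0ᴾ
num-nonzero f f≉0 n≈0 = f≉0 (*1-zero (num f) n≈0)
  where
  *1-zero : ∀ p → p ≈ᴾ 0ᴾ → p *ᴾ 1ᴾ ≈ᴾ 0ᴾ
  *1-zero []      _   k       = refl
  *1-zero (a ∷ p) p≈0 zero    with refl ← p≈0 zero = refl
  *1-zero (a ∷ p) p≈0 (suc k) =
    trans (coeff-* a p 1ᴾ (suc k))
          (cong₂ _+_ (ℤ.*-zeroʳ a) (*1-zero p (λ i → p≈0 (suc i)) k))

divide : (f g : RatFun) → ¬ g ≈ 0ᴿ → RatFun
divide f g g≉0 = (num f *ᴾ den g) /ᴾ (den f *ᴾ num g)
  ⟨ *ᴾ-nonzero (den f) (num g) (den≉0 f) (num-nonzero g g≉0) ⟩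

-- Horner evaluation of a polynomial at an element of ℚ(X).
eval : Poly → RatFun → RatFun
eval []      r = 0ᴿ
eval (a ∷ p) r = const a +ᴿ r *ᴿ eval p r

-- The composite f(r) exists when the denominator of f does not vanish at r.
DefinedAt : RatFun → RatFun → Set
DefinedAt f r = ¬ eval (den f) r ≈ 0ᴿ

substitute : (f r : RatFun) → DefinedAt f r → RatFun
substitute f r d = divide (eval (num f) r) (eval (den f) r) d

------------------------------------------------------------------------
-- Formal power series

Series : Set
Series = ℕ → ℤ

infixl 7 _⊛_
_⊛_ : Series → Series → Series
(f ⊛ g) k = sum {suc k} λ i → f (toℕ i) * g (k ∸ toℕ i)
  where open Det ℤ.+-*-rawRing using (sum)

-- Σ s_l t^l equals the rational function f(t), i.e. den f · Σ s_l t^l = num f.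
IsRationalFormOf : RatFun → Series → Set
IsRationalFormOf f s = ∀ k → (coeff (den f) ⊛ s) k ≡ coeff (num f) k

------------------------------------------------------------------------
-- Hypergraphs

record Hypergraph (n : ℕ) : Set where
  field
    edges  : List (Subset n)
    unique : Unique edges

open Hypergraph public

adjacency : ∀ {n} → Hypergraph n → Matrix ℤ n
adjacency G i j =
  if does (i Fin.≟ j) then 0ℤ
  else + length (filter (λ e → (⁅ i ⁆ ∪ ⁅ j ⁆) ⊆? e) (edges G))

seidel : ∀ {n} → Hypergraph n → Matrix ℤ n
seidel {n} G i j = 1ℤ - identity n i j - + 2 * adjacency G i j
  where open Det ℤ.+-*-rawRing using (identity)

-- A candidate walk w₀,f₁,w₁,…,f_l,w_l is stored as w₀ together with the
-- vector of steps (f₁,w₁),…,(f_l,w_l).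
Steps : ℕ → ℕ → Set
Steps n l = Vec (Subset n × Fin n) l

IsWalk : ∀ {n l} → Fin n → Steps n l → Set
IsWalk w Vec.[]             = ⊤
IsWalk w ((f , w′) Vec.∷ s) = (w ≢ w′) × (w ∈ f) × (w′ ∈ f) × IsWalk w′ s

isWalk? : ∀ {n l} (w : Fin n) (s : Steps n l) → Dec (IsWalk w s)
isWalk? w Vec.[]             = yes tt
isWalk? w ((f , w′) Vec.∷ s) =
  ¬? (w Fin.≟ w′) ×-dec (w ∈? f) ×-dec (w′ ∈? f) ×-dec isWalk? w′ s

-- Every sequence of l steps with f_i ∈ E and w_i ∈ V, each listed once.
allSteps : ∀ {n} → Hypergraph n → (l : ℕ) → List (Steps n l)
allSteps     G zero    = Vec.[] ∷ []
allSteps {n} G (suc l) =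
  cartesianProductWith Vec._∷_ (cartesianProduct (edges G) (allFin n)) (allSteps G l)

walks : ∀ {n} → Hypergraph n → (l : ℕ) → List (Fin n × Steps n l)
walks {n} G l =
  filter (λ ws → isWalk? (proj₁ ws) (proj₂ ws)) (cartesianProduct (allFin n) (allSteps G l))

walkSeries : ∀ {n} → Hypergraph n → Series
walkSeries G l = + length (walks G l)

------------------------------------------------------------------------
-- The arguments occurring in the identity, as elements of ℚ(λ)

X+1 : Poly
X+1 = Xᴾ +ᴾ 1ᴾ

X+1-nonzero : ¬ X+1 ≈ᴾ 0ᴾ
X+1-nonzero eq with () ← eq zero

2ᴾ-nonzero : ¬ constᴾ (+ 2) ≈ᴾ 0ᴾ
2ᴾ-nonzero eq with () ← eq zero

-1/⟨λ+1⟩ -2/⟨λ+1⟩ -⟨λ+1⟩/2 : RatFun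
-1/⟨λ+1⟩ = constᴾ -1ℤ /ᴾ X+1 ⟨ X+1-nonzero ⟩
-2/⟨λ+1⟩ = constᴾ (ℤ.- + 2) /ᴾ X+1 ⟨ X+1-nonzero ⟩
-⟨λ+1⟩/2 = (-ᴾ X+1) /ᴾ constᴾ (+ 2) ⟨ 2ᴾ-nonzero ⟩

{-# OPTIONS --safe #-}

-- Write K = I - tA, D = det K and N for the sum of the entries of adj K. The
-- walk counts form a row vector w of power series with w K = (1,…,1), whence
-- N = D · Σ w_i = D · H. On the other hand det (K + v J) = D + v N, by row
-- operations on K bordered by a row and a column. At t = -2/(λ+1) the matrix
-- λI - S is (λ+1) (K - (λ+1)⁻¹ J), while (λ+1) K is -2 (-(λ+1)/2 · I - A).
module Submission where

open import Defs hiding (_≈_; const)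
open import Algebra.Bundles using (CommutativeRing; RawRing)
import Algebra.Morphism.Construct.Composition as Composition
import Algebra.Morphism.RingMonomorphism as RingMonomorphism
open import Algebra.Morphism.Structures using (IsRingHomomorphism)
import Algebra.Solver.Ring
open import Algebra.Solver.Ring.AlmostCommutativeRing
  using (fromCommutativeRing; _-Raw-AlmostCommutative⟶_)
open import Algebra.Structures using (IsCommutativeRing)
open import Data.Bool.Base using (true; false; if_then_else_)
open import Data.Empty using (⊥-elim)
open import Data.Fin.Base as Fin using (Fin; toℕ; punchIn)
open import Data.Fin.Properties using () renaming (_≟_ to _≟ᶠ_)
open import Data.Fin.Subset using (Subset; _∈_; _∪_; ⁅_⁆; _⊆_)
open import Data.Fin.Subset.Properties
  using (_∈?_; _⊆?_; x∈⁅x⁆; x∈⁅y⁆⇒x≡y; x∈p∪q⁻; x∈p∪q⁺)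
open import Data.Integer.Base as ℤ using (ℤ; 0ℤ; 1ℤ; -1ℤ; +_)
import Data.Integer.Properties as ℤ
open import Data.Integer.Solver using (module +-*-Solver)
open import Data.List.Base as List using (List; []; _∷_)
open import Data.Maybe.Base using (Maybe; map)
open import Data.Nat.Base as ℕ using (ℕ)
open import Data.Product.Base using (Σ; ∃; _×_; _,_; proj₁; proj₂)
open import Data.Sum.Base using (inj₁; inj₂; [_,_]′)
open import Data.Unit.Base using (⊤; tt)
open import Data.Vec.Base as Vec using ()
open import Data.Vec.Functional using (Vector; updateAt; tail) renaming (_∷_ to _∷ᵛ_)
open import Data.Vec.Functional.Properties using (updateAt-updates; updateAt-minimal)
open import Function.Base using (_∘_; id)
open import Function.Bundles using (mk⇔)
open import Level using (0ℓ)
open import Relation.Binary.Consequences using (dec⇒weaklyDec)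
open import Relation.Binary.Definitions using (Reflexive; Symmetric; Transitive)
open import Relation.Binary.PropositionalEquality as ≡ using (_≡_; _≢_)
open import Relation.Nullary using (¬_; Dec; does; yes; no)
open import Relation.Nullary.Decidable using (_×-dec_; ¬?; does-⇔)

-- A power series has no value at an element of ℚ(λ), so H cannot simply be evaluated at -2/(λ+1).
-- The identity N = D · H is therefore proved in ℤ[[t]]; for any rational form p/d of the walk
-- series it becomes dN = pD in ℤ[t], which survives substitution. Reading off N = hD afterwards,
-- where h is the value of p/d, means dividing by the value of d. Every rational form is allowed, so
-- d may be any nonzero polynomial, and its value at -2/(λ+1) has to be nonzero whatever d is. The
-- matrix K is never inverted: w takes the place of (1,...,1) K⁻¹, and adj K enters only through a
-- bordered determinant. Hence the determinant arguments work over any commutative ring, and the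
-- same ones serve ℤ, ℤ[t], ℤ[[t]] and ℚ(λ); homomorphisms out of ℤ[t] carry the determinants along.

pattern 0F = Fin.zero
pattern 1+ i = Fin.suc i

-- Determinants over a commutative ring

module Determinant (R : CommutativeRing 0ℓ 0ℓ) where
  open CommutativeRing R
  open Det rawRing public
  open import Algebra.Properties.Semiring.Exp semiring using (_^_)
  open import Algebra.Properties.Semiring.Sum semiring
    using (sum-cong-≋; sum-replicate-zero; ∑-distrib-+; *-distribˡ-sum)
  open import Algebra.Properties.Ring ring using (-1*x≈-x; -‿distribˡ-*; -‿distribʳ-*; -‿involutive)
  open import Algebra.Solver.Ring.NaturalCoefficients.Default commutativeSemiring
    using (solve; _:+_; _:*_; _:=_)
  open import Relation.Binary.Reasoning.Setoid setoid

  Row : ℕ → Set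
  Row = Vector Carrier

  infix 4 _≋_
  _≋_ : ∀ {m n} → Vector (Row n) m → Vector (Row n) m → Set
  M ≋ N = ∀ i j → M i j ≈ N i j

  minor : ∀ {n} → Matrix Carrier (ℕ.suc n) → Fin (ℕ.suc n) → Matrix Carrier n
  minor M j i k = M (1+ i) (punchIn j k)

  sign : ∀ {n} → Fin n → Carrier
  sign j = (- 1#) ^ toℕ j

  sum-zero : ∀ {n} {x : Vector Carrier n} → (∀ i → x i ≈ 0#) → sum x ≈ 0#
  sum-zero {n} x≈0 = trans (sum-cong-≋ x≈0) (sum-replicate-zero n)

  det-cong : ∀ {n} {M N : Matrix Carrier n} → M ≋ N → det M ≈ det N
  det-cong {ℕ.zero}  M≋N = refl
  det-cong {ℕ.suc n} M≋N = sum-cong-≋ λ j → *-congˡ {sign j}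
    (*-cong (M≋N 0F j) (det-cong λ i k → M≋N (1+ i) (punchIn j k)))

  -- Laplace expansion works term by term. If `i` is the first row, the minors of all three matrices
  -- agree and the first-row entries combine; otherwise the first rows agree and the minors are
  -- treated by induction.
  det-linear : ∀ {n} {M N P : Matrix Carrier n} c i →
    (∀ j → M i j ≈ N i j + c * P i j) →
    (∀ k → k ≢ i → ∀ j → M k j ≈ N k j) →
    (∀ k → k ≢ i → ∀ j → M k j ≈ P k j) →
    det M ≈ det N + c * det P
  det-linear {ℕ.suc n} {M} {N} {P} c i Mᵢ M≈N M≈P =
    trans (sum-cong-≋ (term i Mᵢ M≈N M≈P))
      (trans (∑-distrib-+ (t N) (λ j → c * t P j))
             (+-congˡ (sym (*-distribˡ-sum c (t P)))))
    where
    t : Matrix Carrier (ℕ.suc n) → Fin (ℕ.suc n) → Carrier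
    t Q j = sign j * (Q 0F j * det (minor Q j))
    term : ∀ i → (∀ j → M i j ≈ N i j + c * P i j) →
      (∀ k → k ≢ i → ∀ j → M k j ≈ N k j) → (∀ k → k ≢ i → ∀ j → M k j ≈ P k j) →
      ∀ j → t M j ≈ t N j + c * t P j
    term 0F M₀ M≈N M≈P j = begin
      t M j
        ≈⟨ *-congˡ (*-congʳ (M₀ j)) ⟩
      sign j * ((N 0F j + c * P 0F j) * det (minor M j))
        ≈⟨ solve 5 (λ s a c b d → s :* ((a :+ c :* b) :* d) := s :* (a :* d) :+ c :* (s :* (b :* d)))
             refl (sign j) (N 0F j) c (P 0F j) (det (minor M j)) ⟩
      sign j * (N 0F j * det (minor M j)) + c * (sign j * (P 0F j * det (minor M j)))
        ≈⟨ +-cong (*-congˡ (*-congˡ (det-cong λ i k → M≈N (1+ i) (λ ()) (punchIn j k))))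
                  (*-congˡ (*-congˡ (*-congˡ (det-cong λ i k → M≈P (1+ i) (λ ()) (punchIn j k))))) ⟩
      t N j + c * t P j ∎
    term (1+ i) Mᵢ M≈N M≈P j = begin
      t M j
        ≈⟨ *-congˡ (*-congˡ (det-linear c i (λ k → Mᵢ (punchIn j k))
             (λ k k≢i l → M≈N (1+ k) (λ { ≡.refl → k≢i ≡.refl }) (punchIn j l))
             (λ k k≢i l → M≈P (1+ k) (λ { ≡.refl → k≢i ≡.refl }) (punchIn j l)))) ⟩
      sign j * (M 0F j * (det (minor N j) + c * det (minor P j)))
        ≈⟨ solve 5 (λ s a c d e → s :* (a :* (d :+ c :* e)) := s :* (a :* d) :+ c :* (s :* (a :* e)))
             refl (sign j) (M 0F j) c (det (minor N j)) (det (minor P j)) ⟩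
      sign j * (M 0F j * det (minor N j)) + c * (sign j * (M 0F j * det (minor P j)))
        ≈⟨ +-cong (*-congˡ (*-congʳ (M≈N 0F (λ ()) j)))
                  (*-congˡ (*-congˡ (*-congʳ (M≈P 0F (λ ()) j)))) ⟩
      t N j + c * t P j ∎

  minors-vanish : ∀ {n} (M : Matrix Carrier (ℕ.suc n)) →
    (∀ j → det (minor M j) ≈ 0#) → det M ≈ 0#
  minors-vanish M d≈0 = sum-zero λ j →
    trans (*-congˡ {sign j} (trans (*-congˡ {M 0F j} (d≈0 j)) (zeroʳ (M 0F j)))) (zeroʳ (sign j))

  -- G j k is a coefficient attached to the pair of distinct columns j and
  -- punchIn j k; the condition says that it depends on the unordered pair only.
  PairSymmetric : ∀ n → (Fin (ℕ.suc n) → Fin n → Carrier) → Set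
  PairSymmetric ℕ.zero    G = ⊤
  PairSymmetric (ℕ.suc n) G =
    (∀ k → G 0F k ≈ G (1+ k) 0F) × PairSymmetric n (λ j k → G (1+ j) (1+ k))

  -- Split off the pairs that contain column 0. The pairs (0, k) and (k+1, 0) have equal
  -- coefficients and the opposite signs (-1)^k and (-1)^(k+1), so they cancel. In a pair of nonzero
  -- columns both signs flip when the indices are lowered, hence the rest is a sum of the same kind
  -- for `n`.
  alternating-sum-vanishes : ∀ n G → PairSymmetric n G →
    (sum λ j → sum λ k → sign j * (sign k * G j k)) ≈ 0#
  alternating-sum-vanishes ℕ.zero    G _               = +-identityʳ 0#
  alternating-sum-vanishes (ℕ.suc n) G (G-sym , G′-sym) = begin
    (sum λ k → 1# * (sign k * G 0F k)) +
      (sum λ j → a j + b j)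
      ≈⟨ +-congˡ (∑-distrib-+ a b) ⟩
    (sum λ k → 1# * (sign k * G 0F k)) + (sum a + sum b)
      ≈⟨ +-assoc _ _ _ ⟨
    (sum λ k → 1# * (sign k * G 0F k)) + sum a + sum b
      ≈⟨ +-cong (sym (∑-distrib-+ (λ k → 1# * (sign k * G 0F k)) a))
           (trans (sum-cong-≋ λ j → sum-cong-≋ λ k → signs j k) (alternating-sum-vanishes n _ G′-sym)) ⟩
    (sum λ k → 1# * (sign k * G 0F k) + a k) + 0#
      ≈⟨ +-identityʳ _ ⟩
    (sum λ k → 1# * (sign k * G 0F k) + a k)
      ≈⟨ sum-zero cancel ⟩
    0# ∎
    where
    a b : Fin (ℕ.suc n) → Carrier
    a j = sign (1+ j) * (1# * G (1+ j) 0F)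
    b j = sum λ k → sign (1+ j) * (sign (1+ k) * G (1+ j) (1+ k))
    cancel : ∀ k → 1# * (sign k * G 0F k) + a k ≈ 0#
    cancel k = begin
      1# * (sign k * G 0F k) + (- 1# * sign k) * (1# * G (1+ k) 0F)
        ≈⟨ +-cong (*-identityˡ _) (*-cong (-1*x≈-x _) (trans (*-identityˡ _) (sym (G-sym k)))) ⟩
      sign k * G 0F k + - sign k * G 0F k
        ≈⟨ distribʳ _ _ _ ⟨
      (sign k + - sign k) * G 0F k
        ≈⟨ *-congʳ (-‿inverseʳ _) ⟩
      0# * G 0F k
        ≈⟨ zeroˡ _ ⟩
      0# ∎
    signs : ∀ j k → sign (1+ j) * (sign (1+ k) * G (1+ j) (1+ k)) ≈ sign j * (sign k * G (1+ j) (1+ k))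
    signs j k = begin
      (- 1# * sign j) * ((- 1# * sign k) * G (1+ j) (1+ k))
        ≈⟨ *-cong (-1*x≈-x _) (trans (*-congʳ (-1*x≈-x _)) (sym (-‿distribˡ-* _ _))) ⟩
      - sign j * - (sign k * G (1+ j) (1+ k))
        ≈⟨ -‿distribˡ-* _ _ ⟨
      - (sign j * - (sign k * G (1+ j) (1+ k)))
        ≈⟨ -‿cong (-‿distribʳ-* _ _) ⟨
      - - (sign j * (sign k * G (1+ j) (1+ k)))
        ≈⟨ -‿involutive _ ⟩
      sign j * (sign k * G (1+ j) (1+ k)) ∎

  pairSymmetric-cong : ∀ n (G H : Fin (ℕ.suc n) → Fin n → Carrier) →
    (∀ j k → G j k ≈ H j k) → PairSymmetric n G → PairSymmetric n H
  pairSymmetric-cong ℕ.zero    G H G≈H _                = tt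
  pairSymmetric-cong (ℕ.suc n) G H G≈H (G-sym , G′-sym) =
    (λ k → trans (sym (G≈H 0F k)) (trans (G-sym k) (G≈H (1+ k) 0F))) ,
    pairSymmetric-cong n _ _ (λ j k → G≈H (1+ j) (1+ k)) G′-sym

  -- d stands for the minor formed by the given columns of the remaining rows.
  ColumnFunction : ℕ → Set
  ColumnFunction m = (Fin m → Fin (ℕ.suc (ℕ.suc m))) → Carrier

  -- A term, without its sign, of the twofold Laplace expansion of a matrix whose first two rows
  -- both equal `a`: column `j` is used in the first row, column `punchIn j k` in the second.
  columnPair : ∀ {m} → Row (ℕ.suc (ℕ.suc m)) → ColumnFunction m →
    Fin (ℕ.suc (ℕ.suc m)) → Fin (ℕ.suc m) → Carrier
  columnPair a d j k = a j * (a (punchIn j k) * d λ l → punchIn j (punchIn k l))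

  Extensional : ∀ {m} → ColumnFunction m → Set
  Extensional d = ∀ f g → (∀ l → f l ≡ g l) → d f ≈ d g

  -- Swapping the two columns exchanges the factors from `a` and leaves the same columns for the
  -- minor. For a pair containing column 0 this is a computation with `punchIn`; for the others
  -- column 0 is peeled off.
  columnPair-symmetric : ∀ m (a : Row (ℕ.suc (ℕ.suc m))) (d : ColumnFunction m) →
    Extensional d → PairSymmetric (ℕ.suc m) (columnPair a d)
  columnPair-symmetric m a d d-cong =
    (λ k → solve 3 (λ x y z → x :* (y :* z) := y :* (x :* z)) refl (a 0F) (a (1+ k)) (d λ l → 1+ (punchIn k l))) ,
    remaining m a d d-cong
    where
    remaining : ∀ m (a : Row (ℕ.suc (ℕ.suc m))) (d : ColumnFunction m) →
      Extensional d → PairSymmetric m λ j k → columnPair a d (1+ j) (1+ k)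
    remaining ℕ.zero    a d d-cong = tt
    -- Column 0 now belongs to the minor as its first column, hence `Fin.lift 1`. The two listings
    -- of the remaining columns agree only pointwise, which is why `d` has to be extensional.
    remaining (ℕ.suc m) a d d-cong = pairSymmetric-cong (ℕ.suc m)
      (columnPair (λ j → a (1+ j)) (λ f → d (Fin.lift 1 f)))
      (λ j k → columnPair a d (1+ j) (1+ k))
      (λ j k → *-congˡ (*-congˡ (d-cong _ _ λ { 0F → ≡.refl ; (1+ l) → ≡.refl })))
      (columnPair-symmetric m (λ j → a (1+ j)) (λ f → d (Fin.lift 1 f))
        (λ f g f≗g → d-cong _ _ λ { 0F → ≡.refl ; (1+ l) → ≡.cong Fin.suc (f≗g l) }))

  det-equal-first-rows : ∀ {n} (M : Matrix Carrier (ℕ.suc (ℕ.suc n))) →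
    (∀ k → M 0F k ≈ M (1+ 0F) k) → det M ≈ 0#
  det-equal-first-rows {n} M M₀≈M₁ = trans (sum-cong-≋ double-sum)
    (alternating-sum-vanishes (ℕ.suc n) G (columnPair-symmetric n (M 0F) d d-cong))
    where
    d : ColumnFunction n
    d f = det λ i l → M (1+ (1+ i)) (f l)
    d-cong : Extensional d
    d-cong f g f≗g = det-cong λ i l → reflexive (≡.cong (M (1+ (1+ i))) (f≗g l))
    G : Fin (ℕ.suc (ℕ.suc n)) → Fin (ℕ.suc n) → Carrier
    G = columnPair (M 0F) d
    double-sum : ∀ j → sign j * (M 0F j * det (minor M j)) ≈ sum λ k → sign j * (sign k * G j k)
    double-sum j = begin
      sign j * (M 0F j * sum s)
        ≈⟨ *-congˡ (*-distribˡ-sum (M 0F j) s) ⟩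
      sign j * sum (λ k → M 0F j * s k)
        ≈⟨ *-distribˡ-sum (sign j) (λ k → M 0F j * s k) ⟩
      sum (λ k → sign j * (M 0F j * s k))
        ≈⟨ sum-cong-≋ (λ k → *-congˡ {sign j} (trans
             (solve 4 (λ x s y z → x :* (s :* (y :* z)) := s :* (x :* (y :* z))) refl
               (M 0F j) (sign k) (M (1+ 0F) (punchIn j k)) (d λ l → punchIn j (punchIn k l)))
             (*-congˡ (*-congˡ (*-congʳ (sym (M₀≈M₁ (punchIn j k)))))))) ⟩
      sum (λ k → sign j * (sign k * G j k)) ∎
      where
      s : Fin (ℕ.suc n) → Carrier
      s k = sign k * (M (1+ 0F) (punchIn j k) * d λ l → punchIn j (punchIn k l))

  Alternating : ℕ → Set
  Alternating n = ∀ (M : Matrix Carrier n) i j → i ≢ j →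
    (∀ k → M i k ≈ M j k) → det M ≈ 0#

  -- With a and b the rows 0 and 1 of M, putting a + b in the rows 1 and j of M
  -- gives 0; expanding by linearity, only det M survives.
  det-alternating-first : ∀ {n} → Alternating n →
    ∀ (M : Matrix Carrier (ℕ.suc n)) j → (∀ k → M 0F k ≈ M (1+ j) k) → det M ≈ 0#
  det-alternating-first                   alt M 0F     M₀≈Mⱼ = det-equal-first-rows M M₀≈Mⱼ
  det-alternating-first {ℕ.suc (ℕ.suc n)} alt M (1+ j) M₀≈Mⱼ = begin
    det M
      ≈⟨ det-cong M≋Xba ⟩
    det (X b a)
      ≈⟨ +-identityʳ _ ⟨
    det (X b a) + 0#
      ≈⟨ +-congˡ (trans (*-congˡ (vanish-1j b b λ _ → refl)) (zeroʳ 1#)) ⟨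
    det (X b a) + 1# * det (X b b)
      ≈⟨ det-linear 1# (1+ (1+ j)) (λ k → trans (at-j b (a ⊕ b) k) (+-cong (sym (at-j b a k)) (*-congˡ (sym (at-j b b k)))))
           (off-j b (a ⊕ b) a) (off-j b (a ⊕ b) b) ⟨
    det (X b (a ⊕ b))
      ≈⟨ trans (+-identityˡ _) (*-identityˡ _) ⟨
    0# + 1# * det (X b (a ⊕ b))
      ≈⟨ +-congʳ (det-equal-first-rows (X a (a ⊕ b)) λ _ → refl) ⟨
    det (X a (a ⊕ b)) + 1# * det (X b (a ⊕ b))
      ≈⟨ det-linear 1# (1+ 0F) (λ _ → refl) (off-1 (a ⊕ b) (a ⊕ b) a) (off-1 (a ⊕ b) (a ⊕ b) b) ⟨
    det (X (a ⊕ b) (a ⊕ b))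
      ≈⟨ vanish-1j (a ⊕ b) (a ⊕ b) (λ _ → refl) ⟩
    0# ∎
    where
    a b : Row (ℕ.suc (ℕ.suc (ℕ.suc n)))
    a = M 0F
    b = M (1+ 0F)
    _⊕_ : (x y : Row (ℕ.suc (ℕ.suc (ℕ.suc n)))) → Row (ℕ.suc (ℕ.suc (ℕ.suc n)))
    (x ⊕ y) k = x k + 1# * y k
    X : (x y : Row (ℕ.suc (ℕ.suc (ℕ.suc n)))) → Matrix Carrier (ℕ.suc (ℕ.suc (ℕ.suc n)))
    X x y = a ∷ᵛ x ∷ᵛ updateAt (tail (tail M)) j (λ _ → y)
    at-j : ∀ x y k → X x y (1+ (1+ j)) k ≈ y k
    at-j x y k = reflexive (≡.cong (λ r → r k) (updateAt-updates j (tail (tail M))))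
    off-j : ∀ x y z k → k ≢ 1+ (1+ j) → ∀ l → X x y k l ≈ X x z k l
    off-j x y z 0F          k≢j l = refl
    off-j x y z (1+ 0F)     k≢j l = refl
    off-j x y z (1+ (1+ k)) k≢j l = reflexive (≡.cong (λ r → r l)
      (≡.trans (updateAt-minimal k j (tail (tail M)) k≢j′) (≡.sym (updateAt-minimal k j (tail (tail M)) k≢j′))))
      where
      k≢j′ : k ≢ j
      k≢j′ ≡.refl = k≢j ≡.refl
    off-1 : ∀ y x x′ k → k ≢ 1+ 0F → ∀ l → X x y k l ≈ X x′ y k l
    off-1 y x x′ 0F          k≢1 l = refl
    off-1 y x x′ (1+ 0F)     k≢1 l = ⊥-elim (k≢1 ≡.refl)
    off-1 y x x′ (1+ (1+ k)) k≢1 l = refl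
    M≋Xba : M ≋ X b a
    M≋Xba 0F          l = refl
    M≋Xba (1+ 0F)     l = refl
    M≋Xba (1+ (1+ k)) l with k ≟ᶠ j
    ... | yes ≡.refl = trans (sym (M₀≈Mⱼ l)) (sym (at-j b a l))
    ... | no  k≢j    = reflexive (≡.cong (λ r → r l) (≡.sym (updateAt-minimal k j (tail (tail M)) k≢j)))
    -- Neither of the equal rows is row 0, so each minor along row 0 still has two equal rows and
    -- the induction hypothesis `alt` applies.
    vanish-1j : ∀ x y → (∀ k → x k ≈ y k) → det (X x y) ≈ 0#
    vanish-1j x y x≈y = minors-vanish (X x y) λ l →
      alt (minor (X x y) l) 0F (1+ j) (λ ()) (λ k → trans (x≈y _) (sym (at-j x y (punchIn l k))))

  det-alternating : ∀ n → Alternating n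
  det-alternating (ℕ.suc n) M 0F     0F     i≢j Mᵢ≈Mⱼ = ⊥-elim (i≢j ≡.refl)
  det-alternating (ℕ.suc n) M (1+ i) (1+ j) i≢j Mᵢ≈Mⱼ = minors-vanish M λ l →
    det-alternating n (minor M l) i j (λ { ≡.refl → i≢j ≡.refl }) (λ k → Mᵢ≈Mⱼ (punchIn l k))
  det-alternating (ℕ.suc n) M (1+ i) 0F     i≢j Mᵢ≈Mⱼ =
    det-alternating-first (det-alternating n) M i (λ k → sym (Mᵢ≈Mⱼ k))
  det-alternating (ℕ.suc n) M 0F     (1+ j) i≢j Mᵢ≈Mⱼ =
    det-alternating-first (det-alternating n) M j Mᵢ≈Mⱼ

  -- Each `V i` put on top of `M` gives determinant 0, so linearity in the first row drops the
  -- summands one by one. The family `V` is kept separate from `M` because the induction shortens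
  -- `V` while `M` stays whole.
  det-add-combination : ∀ {m n} (ρ : Row (ℕ.suc n)) (M : Vector (Row (ℕ.suc n)) n)
    (w : Vector Carrier m) (V : Vector (Row (ℕ.suc n)) m) →
    (∀ i → det (V i ∷ᵛ M) ≈ 0#) →
    det ((λ j → ρ j + sum λ i → w i * V i j) ∷ᵛ M) ≈ det (ρ ∷ᵛ M)
  det-add-combination {ℕ.zero}  ρ M w V det≈0 =
    det-cong {M = (λ j → ρ j + 0#) ∷ᵛ M} {N = ρ ∷ᵛ M} λ { 0F j → +-identityʳ (ρ j) ; (1+ i) j → refl }
  det-add-combination {ℕ.suc m} ρ M w V det≈0 = begin
    det ((λ j → ρ j + (w 0F * V 0F j + rest j)) ∷ᵛ M)
      ≈⟨ det-linear {M = (λ j → ρ j + (w 0F * V 0F j + rest j)) ∷ᵛ M}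
           {N = (λ j → ρ j + rest j) ∷ᵛ M} {P = V 0F ∷ᵛ M} (w 0F) 0F
           (λ j → solve 3 (λ x y z → x :+ (y :+ z) := (x :+ z) :+ y) refl (ρ j) (w 0F * V 0F j) (rest j))
           (λ { 0F 0≢0 → ⊥-elim (0≢0 ≡.refl) ; (1+ k) _ _ → refl })
           (λ { 0F 0≢0 → ⊥-elim (0≢0 ≡.refl) ; (1+ k) _ _ → refl }) ⟩
    det ((λ j → ρ j + rest j) ∷ᵛ M) + w 0F * det (V 0F ∷ᵛ M)
      ≈⟨ +-cong (det-add-combination ρ M (tail w) (tail V) (λ i → det≈0 (1+ i)))
                (trans (*-congˡ (det≈0 0F)) (zeroʳ (w 0F))) ⟩
    det (ρ ∷ᵛ M) + 0#
      ≈⟨ +-identityʳ _ ⟩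
    det (ρ ∷ᵛ M) ∎
    where
    rest : Row _
    rest j = sum λ i → w (1+ i) * V (1+ i) j

  -- Multilinear functions and row operations

  record IsMultilinear {m n} (f : Vector (Row n) m → Carrier) : Set where
    field
      f-cong   : ∀ {M N} → M ≋ N → f M ≈ f N
      f-linear : ∀ {M N P} c i → (∀ j → M i j ≈ N i j + c * P i j) →
        (∀ k → k ≢ i → ∀ j → M k j ≈ N k j) →
        (∀ k → k ≢ i → ∀ j → M k j ≈ P k j) →
        f M ≈ f N + c * f P
  open IsMultilinear

  ∷ᵛ-cong : ∀ {m n} (x : Row n) {M N : Vector (Row n) m} → M ≋ N → (x ∷ᵛ M) ≋ (x ∷ᵛ N)
  ∷ᵛ-cong x M≋N 0F     j = refl
  ∷ᵛ-cong x M≋N (1+ i) j = M≋N i j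

  -- Freezing rows one by one leaves functions of fewer rows of unchanged length; for this reason
  -- `IsMultilinear` does not ask for square matrices.
  ∷ᵛ-multilinear : ∀ {m n} {f : Vector (Row n) (ℕ.suc m) → Carrier} →
    IsMultilinear f → ∀ x → IsMultilinear λ M → f (x ∷ᵛ M)
  f-cong   (∷ᵛ-multilinear f-ml x) M≋N = f-cong f-ml (∷ᵛ-cong x M≋N)
  f-linear (∷ᵛ-multilinear f-ml x) c i Mᵢ M≈N M≈P = f-linear f-ml c (1+ i) Mᵢ
    (λ { 0F _ _ → refl ; (1+ k) k≢i → M≈N k λ { ≡.refl → k≢i ≡.refl } })
    (λ { 0F _ _ → refl ; (1+ k) k≢i → M≈P k λ { ≡.refl → k≢i ≡.refl } })

  -- Row 0 is split by linearity: the summand that has `ρ` as a row vanishes, and in the other one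
  -- row 0 is frozen, which leaves one row fewer to treat.
  multilinear-add-multiples : ∀ {m n} {f : Vector (Row n) m → Carrier} → IsMultilinear f →
    (ρ : Row n) → (∀ M i → (∀ j → M i j ≈ ρ j) → f M ≈ 0#) →
    ∀ (c : Vector Carrier m) M → f (λ i j → M i j + c i * ρ j) ≈ f M
  multilinear-add-multiples {ℕ.zero}      f-ml ρ f≈0 c M = f-cong f-ml λ ()
  multilinear-add-multiples {ℕ.suc m} {n} {f} f-ml ρ f≈0 c M = begin
    f M⁺
      ≈⟨ f-linear f-ml (c 0F) 0F (λ _ → refl)
           (λ { 0F 0≢0 → ⊥-elim (0≢0 ≡.refl) ; (1+ k) _ _ → refl })
           (λ { 0F 0≢0 → ⊥-elim (0≢0 ≡.refl) ; (1+ k) _ _ → refl }) ⟩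
    f (M 0F ∷ᵛ tail M⁺) + c 0F * f (ρ ∷ᵛ tail M⁺)
      ≈⟨ +-cong
           (multilinear-add-multiples (∷ᵛ-multilinear f-ml (M 0F)) ρ
             (λ N i Nᵢ → f≈0 (M 0F ∷ᵛ N) (1+ i) Nᵢ) (tail c) (tail M))
           (trans (*-congˡ (f≈0 (ρ ∷ᵛ tail M⁺) 0F λ _ → refl)) (zeroʳ (c 0F))) ⟩
    f (M 0F ∷ᵛ tail M) + 0#
      ≈⟨ +-identityʳ _ ⟩
    f (M 0F ∷ᵛ tail M)
      ≈⟨ f-cong f-ml (λ { 0F j → refl ; (1+ i) j → refl }) ⟩
    f M ∎
    where
    M⁺ : Vector (Row n) (ℕ.suc m)
    M⁺ i j = M i j + c i * ρ j

  det-multilinear : ∀ {n} → IsMultilinear (det {n})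
  f-cong   det-multilinear = det-cong
  f-linear det-multilinear = det-linear

  det-add-multiples-of-first : ∀ {n} (ρ : Row (ℕ.suc n)) (c : Vector Carrier n) M →
    det (ρ ∷ᵛ λ i j → M i j + c i * ρ j) ≈ det (ρ ∷ᵛ M)
  det-add-multiples-of-first ρ c M = multilinear-add-multiples (∷ᵛ-multilinear det-multilinear ρ) ρ
    (λ N i Nᵢ → det-alternating _ (ρ ∷ᵛ N) 0F (1+ i) (λ ()) (λ j → sym (Nᵢ j))) c M

  det-zero-column : ∀ {n} (M : Matrix Carrier (ℕ.suc n)) → (∀ i → M i 0F ≈ 0#) → det M ≈ 0#
  det-zero-column M col≈0 = sum-zero term
    where
    term : ∀ j → sign j * (M 0F j * det (minor M j)) ≈ 0#
    term 0F = trans (*-congˡ {1#} (trans (*-congʳ (col≈0 0F)) (zeroˡ _))) (zeroʳ _)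
    -- A nonzero column index forces the size to be at least two; the minor then keeps column 0 of
    -- `M` as its own first column.
    term (Fin.suc {n = ℕ.suc n} j) =
      trans (*-congˡ {sign (1+ j)} (trans (*-congˡ {M 0F (1+ j)}
        (det-zero-column (minor M (1+ j)) λ i → col≈0 (1+ i))) (zeroʳ _))) (zeroʳ _)

  -- Bordered determinants

  bordered : ∀ {n} → Carrier → Row n → Row n → Matrix Carrier n → Matrix Carrier (ℕ.suc n)
  bordered x r c M = (x ∷ᵛ r) ∷ᵛ λ i → c i ∷ᵛ M i

  det-bordered-zero-row : ∀ {n} x (c : Row n) M → det (bordered x (λ _ → 0#) c M) ≈ x * det M
  det-bordered-zero-row x c M = begin
    det B
      ≈⟨ +-cong (*-identityˡ _) (sum-zero λ j →
           trans (*-congˡ {sign (1+ j)} (zeroˡ (det (minor B (1+ j))))) (zeroʳ _)) ⟩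
    x * det M + 0#
      ≈⟨ +-identityʳ _ ⟩
    x * det M ∎
    where
    B : Matrix Carrier _
    B = bordered x (λ _ → 0#) c M

  det-bordered-zero-column : ∀ {n} x (r : Row n) M → det (bordered x r (λ _ → 0#) M) ≈ x * det M
  det-bordered-zero-column {n} x r M = begin
    det B
      ≈⟨ +-cong (*-identityˡ _) (sum-zero λ j →
           trans (*-congˡ {sign (1+ j)} (trans (*-congˡ {r j} (minor-vanishes j)) (zeroʳ _))) (zeroʳ _)) ⟩
    x * det M + 0#
      ≈⟨ +-identityʳ _ ⟩
    x * det M ∎
    where
    B : Matrix Carrier (ℕ.suc n)
    B = bordered x r (λ _ → 0#) M
    minor-vanishes : ∀ j → det (minor B (1+ j)) ≈ 0#
    -- Both clauses are alike; splitting `j` shows that `n` is a successor, as `det-zero-column`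
    -- demands.
    minor-vanishes j@0F     = det-zero-column (minor B (1+ j)) λ _ → refl
    minor-vanishes j@(1+ _) = det-zero-column (minor B (1+ j)) λ _ → refl

  -- Expanding along the border shows that this is the sum of the entries of adj M.
  adjugateSum : ∀ {n} → Matrix Carrier n → Carrier
  adjugateSum M = - det (bordered 0# (λ _ → 1#) (λ _ → 1#) M)

  -- Put the row (1, -v, ..., -v) on top of the rows (1, Mᵢ). Subtracting it from these rows clears
  -- column 0 below the corner and adds v to every entry of `M`. Without the subtraction, linearity
  -- in the top row, which is (1, 0, ..., 0) - v (0, 1, ..., 1), gives the two summands.
  det-add-constant : ∀ {n} (M : Matrix Carrier n) v →
    det (λ i j → M i j + v) ≈ det M + v * adjugateSum M
  det-add-constant M v = begin
    det (λ i j → M i j + v)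
      ≈⟨ *-identityˡ _ ⟨
    1# * det (λ i j → M i j + v)
      ≈⟨ det-bordered-zero-column 1# (λ _ → - v) (λ i j → M i j + v) ⟨
    det (bordered 1# (λ _ → - v) (λ _ → 0#) λ i j → M i j + v)
      ≈⟨ det-cong {M = bordered 1# (λ _ → - v) (λ _ → 0#) λ i j → M i j + v}
           {N = ρ ∷ᵛ λ i j → (1# ∷ᵛ M i) j + - 1# * ρ j}
           (λ { 0F j → refl
                     ; (1+ i) 0F → sym (trans (+-congˡ (*-identityʳ (- 1#))) (-‿inverseʳ 1#))
                     ; (1+ i) (1+ j) → +-congˡ (sym (trans (-1*x≈-x _) (-‿involutive v))) }) ⟩
    det (ρ ∷ᵛ λ i j → (1# ∷ᵛ M i) j + - 1# * ρ j)
      ≈⟨ det-add-multiples-of-first ρ (λ _ → - 1#) (λ i → 1# ∷ᵛ M i) ⟩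
    det (ρ ∷ᵛ λ i → 1# ∷ᵛ M i)
      ≈⟨ det-linear {M = ρ ∷ᵛ λ i → 1# ∷ᵛ M i} {N = bordered 1# (λ _ → 0#) (λ _ → 1#) M}
           {P = bordered 0# (λ _ → 1#) (λ _ → 1#) M} (- v) 0F
           (λ { 0F → sym (trans (+-congˡ (zeroʳ _)) (+-identityʳ 1#))
              ; (1+ j) → sym (trans (+-identityˡ _) (*-identityʳ _)) })
           (λ { 0F 0≢0 → ⊥-elim (0≢0 ≡.refl) ; (1+ k) _ _ → refl })
           (λ { 0F 0≢0 → ⊥-elim (0≢0 ≡.refl) ; (1+ k) _ _ → refl }) ⟩
    det (bordered 1# (λ _ → 0#) (λ _ → 1#) M) + - v * det (bordered 0# (λ _ → 1#) (λ _ → 1#) M)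
      ≈⟨ +-cong (trans (det-bordered-zero-row 1# (λ _ → 1#) M) (*-identityˡ _))
                (trans (sym (-‿distribˡ-* v _)) (-‿distribʳ-* v _)) ⟩
    det M + v * adjugateSum M ∎
    where
    ρ : Row _
    ρ = 1# ∷ᵛ λ _ → - v

  -- The border row (0, 1, ..., 1) is (- sum w, 0, ..., 0) plus the combination, with weights `w`,
  -- of the rows (1, Mᵢ) beneath it. Dropping the combination leaves only the corner in the top row.
  -- Here `w` does the work of (1, ..., 1) M⁻¹ without an inverse of `M`.
  adjugateSum-resolvent : ∀ {n} (M : Matrix Carrier n) w →
    (∀ j → (sum λ i → w i * M i j) ≈ 1#) → adjugateSum M ≈ sum w * det M
  adjugateSum-resolvent {n} M w wM≈1 = begin
    - det (bordered 0# (λ _ → 1#) (λ _ → 1#) M)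
      ≈⟨ -‿cong (det-cong {M = bordered 0# (λ _ → 1#) (λ _ → 1#) M}
             {N = (λ j → ρ j + sum λ i → w i * (1# ∷ᵛ M i) j) ∷ᵛ λ i → 1# ∷ᵛ M i}
           λ { 0F 0F → sym (trans (+-congˡ (sum-cong-≋ λ i → *-identityʳ (w i))) (-‿inverseˡ _))
                            ; 0F (1+ j) → sym (trans (+-identityˡ _) (wM≈1 j))
                            ; (1+ i) j → refl }) ⟩
    - det ((λ j → ρ j + sum λ i → w i * (1# ∷ᵛ M i) j) ∷ᵛ λ i → 1# ∷ᵛ M i)
      ≈⟨ -‿cong (det-add-combination ρ (λ i → 1# ∷ᵛ M i) w (λ i → 1# ∷ᵛ M i)
           λ i → det-alternating _ ((1# ∷ᵛ M i) ∷ᵛ λ i → 1# ∷ᵛ M i) 0F (1+ i) (λ ()) (λ _ → refl)) ⟩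
    - det (bordered (- sum w) (λ _ → 0#) (λ _ → 1#) M)
      ≈⟨ -‿cong (det-bordered-zero-row (- sum w) (λ _ → 1#) M) ⟩
    - (- sum w * det M)
      ≈⟨ -‿cong (-‿distribˡ-* (sum w) (det M)) ⟨
    - - (sum w * det M)
      ≈⟨ -‿involutive _ ⟩
    sum w * det M ∎
    where
    ρ : Row (ℕ.suc n)
    ρ = (- sum w) ∷ᵛ λ _ → 0#

  det-scale : ∀ {n} c (M : Matrix Carrier n) → det (λ i j → c * M i j) ≈ c ^ n * det M
  det-scale {ℕ.zero}  c M = sym (*-identityˡ 1#)
  det-scale {ℕ.suc n} c M = sym (trans (*-distribˡ-sum (c * c ^ n) t) (sum-cong-≋ λ j → sym (begin
    sign j * (c * M 0F j * det (λ i k → c * minor M j i k))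
      ≈⟨ *-congˡ (*-congˡ (det-scale c (minor M j))) ⟩
    sign j * (c * M 0F j * (c ^ n * det (minor M j)))
      ≈⟨ solve 5 (λ s c a e d → s :* (c :* a :* (e :* d)) := c :* e :* (s :* (a :* d)))
           refl (sign j) c (M 0F j) (c ^ n) (det (minor M j)) ⟩
    c * c ^ n * t j ∎)))
    where
    t : Fin (ℕ.suc n) → Carrier
    t j = sign j * (M 0F j * det (minor M j))

  det-identity : ∀ n → det (identity n) ≈ 1#
  det-identity ℕ.zero    = refl
  det-identity (ℕ.suc n) = begin
    det (identity (ℕ.suc n))
      ≈⟨ det-cong {M = identity (ℕ.suc n)} {N = bordered 1# (λ _ → 0#) (λ _ → 0#) (identity n)}
           (λ { 0F 0F → refl ; 0F (1+ j) → refl ; (1+ i) 0F → refl ; (1+ i) (1+ j) → refl }) ⟩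
    det (bordered 1# (λ _ → 0#) (λ _ → 0#) (identity n))
      ≈⟨ det-bordered-zero-row 1# (λ _ → 0#) (identity n) ⟩
    1# * det (identity n)
      ≈⟨ trans (*-identityˡ _) (det-identity n) ⟩
    1# ∎

-- Building rings and homomorphisms

module _ (R : RawRing 0ℓ 0ℓ) where
  open RawRing R
  open import Algebra.Definitions (RawRing._≈_ R)

  record CommutativeRingLaws : Set where
    field
      refl        : Reflexive _≈_
      sym         : Symmetric _≈_
      trans       : Transitive _≈_
      +-cong      : Congruent₂ _+_
      *-cong      : Congruent₂ _*_
      -‿cong      : Congruent₁ -_
      +-assoc     : Associative _+_
      +-comm      : Commutative _+_
      +-identityˡ : LeftIdentity 0# _+_
      -‿inverseˡ  : LeftInverse 0# -_ _+_
      *-assoc     : Associative _*_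
      *-comm      : Commutative _*_
      *-identityˡ : LeftIdentity 1# _*_
      distribʳ    : _*_ DistributesOverʳ _+_

    isCommutativeRing : IsCommutativeRing _≈_ _+_ _*_ -_ 0# 1#
    isCommutativeRing = record
      { isRing = record
        { +-isAbelianGroup = record
          { isGroup = record
            { isMonoid = record
              { isSemigroup = record
                { isMagma = record
                  { isEquivalence = record { refl = refl ; sym = sym ; trans = trans }
                  ; ∙-cong = +-cong }
                ; assoc = +-assoc }
              ; identity = +-identityˡ , λ x → trans (+-comm _ _) (+-identityˡ x) }
            ; inverse = -‿inverseˡ , λ x → trans (+-comm _ _) (-‿inverseˡ x)
            ; ⁻¹-cong = -‿cong }
          ; comm = +-comm }
        ; *-cong = *-cong
        ; *-assoc = *-assoc
        ; *-identity = *-identityˡ , λ x → trans (*-comm _ _) (*-identityˡ x)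
        ; distrib =
            (λ x y z → trans (*-comm _ _)
              (trans (distribʳ x y z) (+-cong (*-comm _ _) (*-comm _ _)))) ,
            distribʳ }
      ; *-comm = *-comm }

    commutativeRing : CommutativeRing 0ℓ 0ℓ
    commutativeRing = record { isCommutativeRing = isCommutativeRing }

module _ (R S : RawRing 0ℓ 0ℓ) where
  private
    module R = RawRing R
    module S = RawRing S

  record HomomorphismLaws (φ : R.Carrier → S.Carrier) : Set where
    field
      cong : ∀ {x y} → x R.≈ y → φ x S.≈ φ y
      +-homo : ∀ x y → φ (x R.+ y) S.≈ φ x S.+ φ y
      *-homo : ∀ x y → φ (x R.* y) S.≈ φ x S.* φ y
      -‿homo : ∀ x → φ (R.- x) S.≈ S.- φ x
      0#-homo : φ R.0# S.≈ S.0#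
      1#-homo : φ R.1# S.≈ S.1#

    isRingHomomorphism : IsRingHomomorphism R S φ
    isRingHomomorphism = record
      { isSemiringHomomorphism = record
        { isNearSemiringHomomorphism = record
          { +-isMonoidHomomorphism = record
            { isMagmaHomomorphism = record
              { isRelHomomorphism = record { cong = cong }
              ; homo = +-homo }
            ; ε-homo = 0#-homo }
          ; *-homo = *-homo }
        ; 1#-homo = 1#-homo }
      ; -‿homo = -‿homo }

-- Determinants under ring homomorphisms

module _ {R S : CommutativeRing 0ℓ 0ℓ} {φ : CommutativeRing.Carrier R → CommutativeRing.Carrier S}
  (φ-homo : IsRingHomomorphism (CommutativeRing.rawRing R) (CommutativeRing.rawRing S) φ) where
  private
    module R where
      open CommutativeRing R public
      open Determinant R public
      open import Algebra.Properties.Semiring.Exp semiring public using (_^_)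
    module S where
      open CommutativeRing S public
      open Determinant S public
      open import Algebra.Properties.Semiring.Exp semiring public using (_^_)
      open import Algebra.Properties.Semiring.Sum semiring public using (sum-cong-≋)
  open IsRingHomomorphism φ-homo

  sum-homo : ∀ {n} (x : Fin n → R.Carrier) → φ (R.sum x) S.≈ S.sum (λ i → φ (x i))
  sum-homo {ℕ.zero}  x = 0#-homo
  sum-homo {ℕ.suc n} x = S.trans (+-homo _ _) (S.+-congˡ (sum-homo (λ i → x (1+ i))))

  sign-homo : ∀ {n} (j : Fin n) → φ (R.sign j) S.≈ S.sign j
  sign-homo j = power (toℕ j)
    where
    power : ∀ n → φ ((R.- R.1#) R.^ n) S.≈ (S.- S.1#) S.^ n
    power ℕ.zero    = 1#-homo
    power (ℕ.suc n) = S.trans (*-homo _ _)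
      (S.*-cong (S.trans (-‿homo _) (S.-‿cong 1#-homo)) (power n))

  -- The Laplace formula is built from ring operations. This lets the determinant of I - tA be read
  -- as a power series, at t = 0 in ℤ, and at t = -2/(λ+1) in ℚ(λ).
  det-homo : ∀ {n} (M : Matrix R.Carrier n) → φ (R.det M) S.≈ S.det (λ i j → φ (M i j))
  det-homo {ℕ.zero}  M = 1#-homo
  det-homo {ℕ.suc n} M = S.trans
    (sum-homo λ j → R.sign j R.* (M 0F j R.* R.det (R.minor M j)))
    (S.sum-cong-≋ λ j → S.trans (*-homo (R.sign j) _) (S.*-cong (sign-homo j)
      (S.trans (*-homo (M 0F j) _) (S.*-congˡ {φ (M 0F j)} (det-homo (R.minor M j))))))

  adjugateSum-homo : ∀ {n} (M : Matrix R.Carrier n) →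
    φ (R.adjugateSum M) S.≈ S.adjugateSum (λ i j → φ (M i j))
  adjugateSum-homo {n} M = S.trans (-‿homo _) (S.-‿cong (S.trans (det-homo B)
    (S.det-cong {M = λ i j → φ (B i j)}
      {N = S.bordered S.0# (λ _ → S.1#) (λ _ → S.1#) λ i j → φ (M i j)}
      λ { 0F 0F → 0#-homo ; 0F (1+ j) → 1#-homo
        ; (1+ i) 0F → 1#-homo ; (1+ i) (1+ j) → S.refl })))
    where
    B : Matrix R.Carrier (ℕ.suc n)
    B = R.bordered R.0# (λ _ → R.1#) (λ _ → R.1#) M

  identity-homo : ∀ {n} (i j : Fin n) → φ (R.identity n i j) S.≈ S.identity n i j
  identity-homo i j with does (i ≟ᶠ j)
  ... | true  = 1#-homo
  ... | false = 0#-homo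

-- Power series and polynomials

ℤ-ring : CommutativeRing 0ℓ 0ℓ
ℤ-ring = ℤ.+-*-commutativeRing

module ℤΣ = Determinant ℤ-ring
open import Algebra.Properties.Semiring.Sum (CommutativeRing.semiring ℤ-ring)
  using (sum-cong-≗; sum-replicate-zero; ∑-distrib-+; *-distribˡ-sum)

seriesRawRing : RawRing 0ℓ 0ℓ
seriesRawRing = record
  { Carrier = Series
  ; _≈_     = λ f g → ∀ k → f k ≡ g k
  ; _+_     = λ f g k → f k ℤ.+ g k
  ; _*_     = _⊛_
  ; -_      = λ f k → ℤ.- f k
  ; 0#      = coeff 0ᴾ
  ; 1#      = coeff 1ᴾ
  }

⊛-cong : ∀ {f f′ g g′ : Series} → (∀ k → f k ≡ f′ k) → (∀ k → g k ≡ g′ k) →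
  ∀ k → (f ⊛ g) k ≡ (f′ ⊛ g′) k
⊛-cong f≗f′ g≗g′ k = sum-cong-≗ {ℕ.suc k} λ i →
  ≡.cong₂ ℤ._*_ (f≗f′ (toℕ i)) (g≗g′ (k ℕ.∸ toℕ i))

⊛-distribʳ : ∀ (h f g : Series) k → ((λ i → f i ℤ.+ g i) ⊛ h) k ≡ (f ⊛ h) k ℤ.+ (g ⊛ h) k
⊛-distribʳ h f g k = ≡.trans
  (sum-cong-≗ {ℕ.suc k} λ i → ℤ.*-distribʳ-+ (h (k ℕ.∸ toℕ i)) (f (toℕ i)) (g (toℕ i)))
  (∑-distrib-+ {ℕ.suc k} (λ i → f (toℕ i) ℤ.* h (k ℕ.∸ toℕ i)) (λ i → g (toℕ i) ℤ.* h (k ℕ.∸ toℕ i)))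

⊛-scale : ∀ a (f h : Series) k → ((λ i → a ℤ.* f i) ⊛ h) k ≡ a ℤ.* (f ⊛ h) k
⊛-scale a f h k = ≡.trans
  (sum-cong-≗ {ℕ.suc k} λ i → ℤ.*-assoc a (f (toℕ i)) (h (k ℕ.∸ toℕ i)))
  (≡.sym (*-distribˡ-sum {ℕ.suc k} a (λ i → f (toℕ i) ℤ.* h (k ℕ.∸ toℕ i))))

⊛-zeroˡ : ∀ (f : Series) k → (coeff 0ᴾ ⊛ f) k ≡ 0ℤ
⊛-zeroˡ f k = ⊛-scale 0ℤ (coeff 0ᴾ) f k

⊛-identityˡ : ∀ (f : Series) k → (coeff 1ᴾ ⊛ f) k ≡ f k
⊛-identityˡ f ℕ.zero    = ≡.trans (ℤ.+-identityʳ _) (ℤ.*-identityˡ _)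
⊛-identityˡ f (ℕ.suc k) = ≡.trans
  (≡.cong₂ ℤ._+_ (ℤ.*-identityˡ (f (ℕ.suc k))) (⊛-zeroˡ f k)) (ℤ.+-identityʳ _)

-- The definition of `_⊛_` peels off the summand with index 0 in the first factor; this peels off
-- the other end, so that commutativity can match the two.
⊛-last : ∀ (f g : Series) k →
  (f ⊛ g) (ℕ.suc k) ≡ (f ⊛ (g ∘ ℕ.suc)) k ℤ.+ f (ℕ.suc k) ℤ.* g 0
⊛-last f g ℕ.zero    =
  solve 4 (λ a b c d → a :* b :+ (c :* d :+ con 0ℤ) := a :* b :+ con 0ℤ :+ c :* d) ≡.refl
    (f 0) (g 1) (f 1) (g 0)
  where open +-*-Solver
⊛-last f g (ℕ.suc k) = ≡.trans
  (≡.cong (λ x → f 0 ℤ.* g (ℕ.suc (ℕ.suc k)) ℤ.+ x) (⊛-last (f ∘ ℕ.suc) g k))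
  (≡.sym (ℤ.+-assoc (f 0 ℤ.* g (ℕ.suc (ℕ.suc k))) _ _))

⊛-comm : ∀ (f g : Series) k → (f ⊛ g) k ≡ (g ⊛ f) k
⊛-comm f g ℕ.zero    = ≡.cong (ℤ._+ 0ℤ) (ℤ.*-comm (f 0) (g 0))
⊛-comm f g (ℕ.suc k) = ≡.trans
  (≡.cong₂ ℤ._+_ (ℤ.*-comm (f 0) (g (ℕ.suc k))) (⊛-comm (f ∘ ℕ.suc) g k))
  (≡.trans (ℤ.+-comm (g (ℕ.suc k) ℤ.* f 0) _) (≡.sym (⊛-last g f k)))

⊛-assoc : ∀ (f g h : Series) k → ((f ⊛ g) ⊛ h) k ≡ (f ⊛ (g ⊛ h)) k
⊛-assoc f g h ℕ.zero    =
  solve 3 (λ a b c → (a :* b :+ con 0ℤ) :* c :+ con 0ℤ := a :* (b :* c :+ con 0ℤ) :+ con 0ℤ) ≡.refl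
    (f 0) (g 0) (h 0)
  where open +-*-Solver
-- By definition the shift of `f ⊛ g` is `f 0` times the shift of `g`, plus the shift of `f`
-- convolved with `g`; the induction on the index applies to the latter.
⊛-assoc f g h (ℕ.suc k) = begin
  (f ⊛ g) 0 ℤ.* h (ℕ.suc k) ℤ.+ (((f ⊛ g) ∘ ℕ.suc) ⊛ h) k
    ≡⟨ ≡.cong (λ x → (f ⊛ g) 0 ℤ.* h (ℕ.suc k) ℤ.+ x)
         (⊛-distribʳ h (λ i → f 0 ℤ.* g (ℕ.suc i)) ((f ∘ ℕ.suc) ⊛ g) k) ⟩
  (f ⊛ g) 0 ℤ.* h (ℕ.suc k) ℤ.+ (((λ i → f 0 ℤ.* g (ℕ.suc i)) ⊛ h) k ℤ.+ (((f ∘ ℕ.suc) ⊛ g) ⊛ h) k)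
    ≡⟨ ≡.cong₂ (λ x y → (f ⊛ g) 0 ℤ.* h (ℕ.suc k) ℤ.+ (x ℤ.+ y))
         (⊛-scale (f 0) (g ∘ ℕ.suc) h k) (⊛-assoc (f ∘ ℕ.suc) g h k) ⟩
  (f ⊛ g) 0 ℤ.* h (ℕ.suc k) ℤ.+ (f 0 ℤ.* ((g ∘ ℕ.suc) ⊛ h) k ℤ.+ ((f ∘ ℕ.suc) ⊛ (g ⊛ h)) k)
    ≡⟨ solve 5 (λ a b c x y → (a :* b :+ con 0ℤ) :* c :+ (a :* x :+ y) := a :* (b :* c :+ x) :+ y) ≡.refl
         (f 0) (g 0) (h (ℕ.suc k)) (((g ∘ ℕ.suc) ⊛ h) k) (((f ∘ ℕ.suc) ⊛ (g ⊛ h)) k) ⟩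
  (f ⊛ (g ⊛ h)) (ℕ.suc k) ∎
  where
  open +-*-Solver
  open ≡.≡-Reasoning

seriesRing : CommutativeRing 0ℓ 0ℓ
seriesRing = CommutativeRingLaws.commutativeRing {seriesRawRing} record
  { refl        = λ k → ≡.refl
  ; sym         = λ f≗g k → ≡.sym (f≗g k)
  ; trans       = λ f≗g g≗h k → ≡.trans (f≗g k) (g≗h k)
  ; +-cong      = λ f≗f′ g≗g′ k → ≡.cong₂ ℤ._+_ (f≗f′ k) (g≗g′ k)
  ; *-cong      = ⊛-cong
  ; -‿cong      = λ f≗g k → ≡.cong ℤ.-_ (f≗g k)
  ; +-assoc     = λ f g h k → ℤ.+-assoc (f k) (g k) (h k)
  ; +-comm      = λ f g k → ℤ.+-comm (f k) (g k)
  ; +-identityˡ = λ f k → ℤ.+-identityˡ (f k)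
  ; -‿inverseˡ  = λ f k → ℤ.+-inverseˡ (f k)
  ; *-assoc     = ⊛-assoc
  ; *-comm      = ⊛-comm
  ; *-identityˡ = ⊛-identityˡ
  ; distribʳ    = ⊛-distribʳ
  }

coeff-neg : ∀ p k → coeff (-ᴾ p) k ≡ ℤ.- coeff p k
coeff-neg []      k         = ≡.refl
coeff-neg (a ∷ p) ℕ.zero    = ≡.refl
coeff-neg (a ∷ p) (ℕ.suc k) = coeff-neg p k

coeff-*ᴾ : ∀ p q k → coeff (p *ᴾ q) k ≡ (coeff p ⊛ coeff q) k
coeff-*ᴾ []      q k         = ≡.sym (⊛-zeroˡ (coeff q) k)
coeff-*ᴾ (a ∷ p) q ℕ.zero    = coeff-* a p q 0
coeff-*ᴾ (a ∷ p) q (ℕ.suc k) = ≡.trans (coeff-* a p q (ℕ.suc k))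
  (≡.cong (λ x → a ℤ.* coeff q (ℕ.suc k) ℤ.+ x) (coeff-*ᴾ p q k))

coeff-homo : IsRingHomomorphism polyRawRing seriesRawRing coeff
coeff-homo = HomomorphismLaws.isRingHomomorphism record
  { cong    = λ p≈q → p≈q
  ; +-homo  = coeff-+
  ; *-homo  = coeff-*ᴾ
  ; -‿homo  = coeff-neg
  ; 0#-homo = λ k → ≡.refl
  ; 1#-homo = λ k → ≡.refl
  }

-- Since `_≈ᴾ_` is equality of coefficients, `coeff` is injective, and the ring laws descend from
-- power series, where trailing zeros are no issue.
polyRing : CommutativeRing 0ℓ 0ℓ
polyRing = record
  { isCommutativeRing = RingMonomorphism.isCommutativeRing
      (record { isRingHomomorphism = coeff-homo ; injective = λ p≈q → p≈q })
      (CommutativeRing.isCommutativeRing seriesRing) }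

-- The field of rational functions

module Fractions (P : CommutativeRing 0ℓ 0ℓ) where
  open CommutativeRing P
  open import Algebra.Properties.Ring ring using (-‿distribˡ-*)
  open import Algebra.Solver.Ring.NaturalCoefficients.Default commutativeSemiring
    using (solve; _:+_; _:*_; _:=_)

  +ᶠ-cong : ∀ {a b a′ b′ c d c′ d′} → a * b′ ≈ a′ * b → c * d′ ≈ c′ * d →
    (a * d + c * b) * (b′ * d′) ≈ (a′ * d′ + c′ * b′) * (b * d)
  +ᶠ-cong {a} {b} {a′} {b′} {c} {d} {c′} {d′} ab′≈a′b cd′≈c′d = trans
    (solve 6 (λ a b c d b′ d′ →
      (a :* d :+ c :* b) :* (b′ :* d′) := (a :* b′) :* (d :* d′) :+ (c :* d′) :* (b :* b′)) refl a b c d b′ d′)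
    (trans (+-cong (*-congʳ ab′≈a′b) (*-congʳ cd′≈c′d))
    (solve 6 (λ a′ b c′ d b′ d′ →
      (a′ :* b) :* (d :* d′) :+ (c′ :* d) :* (b :* b′) := (a′ :* d′ :+ c′ :* b′) :* (b :* d)) refl a′ b c′ d b′ d′))

  *ᶠ-cong : ∀ {a b a′ b′ c d c′ d′} → a * b′ ≈ a′ * b → c * d′ ≈ c′ * d →
    (a * c) * (b′ * d′) ≈ (a′ * c′) * (b * d)
  *ᶠ-cong {a} {b} {a′} {b′} {c} {d} {c′} {d′} ab′≈a′b cd′≈c′d = trans (interchange a c b′ d′)
    (trans (*-cong ab′≈a′b cd′≈c′d) (interchange a′ b c′ d))
    where
    interchange : ∀ w x y z → (w * x) * (y * z) ≈ (w * y) * (x * z)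
    interchange = solve 4 (λ w x y z → (w :* x) :* (y :* z) := (w :* y) :* (x :* z)) refl

  -ᶠ-cong : ∀ {a b a′ b′} → a * b′ ≈ a′ * b → - a * b′ ≈ - a′ * b
  -ᶠ-cong ab′≈a′b = trans (sym (-‿distribˡ-* _ _)) (trans (-‿cong ab′≈a′b) (-‿distribˡ-* _ _))

  +ᶠ-assoc : ∀ a b c d e f →
    ((a * d + c * b) * f + e * (b * d)) * (b * (d * f)) ≈ (a * (d * f) + (c * f + e * d) * b) * ((b * d) * f)
  +ᶠ-assoc = solve 6 (λ a b c d e f →
    ((a :* d :+ c :* b) :* f :+ e :* (b :* d)) :* (b :* (d :* f))
      := (a :* (d :* f) :+ (c :* f :+ e :* d) :* b) :* ((b :* d) :* f)) refl

  +ᶠ-comm : ∀ a b c d → (a * d + c * b) * (d * b) ≈ (c * b + a * d) * (b * d)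
  +ᶠ-comm = solve 4 (λ a b c d → (a :* d :+ c :* b) :* (d :* b) := (c :* b :+ a :* d) :* (b :* d)) refl

  +ᶠ-identityˡ : ∀ a b → (0# * b + a * 1#) * b ≈ a * (1# * b)
  +ᶠ-identityˡ a b = trans (*-congʳ (trans (+-congʳ (zeroˡ b)) (+-identityˡ _))) (*-assoc a 1# b)

  -ᶠ-inverseˡ : ∀ a b → (- a * b + a * b) * 1# ≈ 0# * (b * b)
  -ᶠ-inverseˡ a b = trans
    (*-congʳ (trans (sym (distribʳ b (- a) a)) (trans (*-congʳ (-‿inverseˡ a)) (zeroˡ b))))
    (trans (zeroˡ 1#) (sym (zeroˡ _)))

  *ᶠ-assoc : ∀ a b c d e f → ((a * c) * e) * (b * (d * f)) ≈ (a * (c * e)) * ((b * d) * f)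
  *ᶠ-assoc = solve 6 (λ a b c d e f →
    ((a :* c) :* e) :* (b :* (d :* f)) := (a :* (c :* e)) :* ((b :* d) :* f)) refl

  *ᶠ-comm : ∀ a b c d → (a * c) * (d * b) ≈ (c * a) * (b * d)
  *ᶠ-comm = solve 4 (λ a b c d → (a :* c) :* (d :* b) := (c :* a) :* (b :* d)) refl

  *ᶠ-identityˡ : ∀ a b → (1# * a) * b ≈ a * (1# * b)
  *ᶠ-identityˡ a b = trans (*-congʳ (*-comm 1# a)) (*-assoc a 1# b)

  *ᶠ-distribʳ : ∀ a b c d e f →
    ((c * f + e * d) * a) * ((d * b) * (f * b)) ≈ ((c * a) * (f * b) + (e * a) * (d * b)) * ((d * f) * b)
  *ᶠ-distribʳ = solve 6 (λ a b c d e f →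
    ((c :* f :+ e :* d) :* a) :* ((d :* b) :* (f :* b))
      := ((c :* a) :* (f :* b) :+ (e :* a) :* (d :* b)) :* ((d :* f) :* b)) refl

  -- The factor `d`, the middle denominator, remains on both sides since `P` may have zero divisors;
  -- for polynomials `*ᴾ-cancelˡ` removes it.
  ≈ᶠ-trans : ∀ {a b c d e f} → a * d ≈ c * b → c * f ≈ e * d → d * (a * f) ≈ d * (e * b)
  ≈ᶠ-trans {a} {b} {c} {d} {e} {f} ad≈cb cf≈ed =
    trans (reverse d a f) (trans (*-congˡ ad≈cb)
      (trans (reverse f c b) (trans (*-congˡ cf≈ed) (reverse b e d))))
    where
    reverse : ∀ x y z → x * (y * z) ≈ z * (y * x)
    reverse = solve 3 (λ x y z → x :* (y :* z) := z :* (y :* x)) refl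

  /ᶠ-cancel : ∀ a b c d → ((a * d) * c) * b ≈ a * ((b * c) * d)
  /ᶠ-cancel = solve 4 (λ a b c d → ((a :* d) :* c) :* b := a :* ((b :* c) :* d)) refl

module _ (P : CommutativeRing 0ℓ 0ℓ) where
  open CommutativeRing P
  open import Algebra.Properties.Ring ring using (x[y-z]≈xy-xz)
  open import Relation.Binary.Reasoning.Setoid setoid

  *-difference-zero : ∀ d x y → d * x ≈ d * y → d * (x - y) ≈ 0#
  *-difference-zero d x y dx≈dy =
    trans (x[y-z]≈xy-xz d x y) (trans (+-congʳ dx≈dy) (-‿inverseʳ (d * y)))

  *-cancelʳ-unit : ∀ {u h} → u * h ≈ 1# → ∀ f g → f * h ≈ g * h → f ≈ g
  *-cancelʳ-unit {u} {h} uh≈1 f g fh≈gh = begin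
    f           ≈⟨ undo f ⟨
    f * h * u   ≈⟨ *-congʳ fh≈gh ⟩
    g * h * u   ≈⟨ undo g ⟩
    g           ∎
    where
    undo : ∀ k → k * h * u ≈ k
    undo k = trans (*-assoc k h u) (trans (*-congˡ (trans (*-comm h u) uh≈1)) (*-identityʳ k))

module ℤX = CommutativeRing polyRing

*ᴾ-cancelˡ : ∀ d p q → ¬ d ≈ᴾ 0ᴾ → d *ᴾ p ≈ᴾ d *ᴾ q → p ≈ᴾ q
*ᴾ-cancelˡ d p q d≉0 dp≈dq =
  [ (λ d≈0 → ⊥-elim (d≉0 d≈0)) , (λ p-q≈0 k → ℤ.i-j≡0⇒i≡j _ _ (≡.trans (≡.sym (coeff-sub k)) (p-q≈0 k))) ]′
    (noZeroDivisorsᴾ d (p +ᴾ -ᴾ q) (*-difference-zero polyRing d p q dp≈dq))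
  where
  coeff-sub : ∀ k → coeff (p +ᴾ -ᴾ q) k ≡ coeff p k ℤ.- coeff q k
  coeff-sub k = ≡.trans (coeff-+ p (-ᴾ q) k) (≡.cong (λ x → coeff p k ℤ.+ x) (coeff-neg q k))

ratFunRawRing : RawRing 0ℓ 0ℓ
ratFunRawRing = record
  { Carrier = RatFun
  ; _≈_     = Defs._≈_
  ; _+_     = _+ᴿ_
  ; _*_     = _*ᴿ_
  ; -_      = λ f → (-ᴾ num f) /ᴾ den f ⟨ den≉0 f ⟩
  ; 0#      = 0ᴿ
  ; 1#      = 1ᴿ
  }

ratFunRing : CommutativeRing 0ℓ 0ℓ
ratFunRing = CommutativeRingLaws.commutativeRing {ratFunRawRing} record
  { refl        = λ {f} → ℤX.refl {num f *ᴾ den f}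
  ; sym         = λ {f} {g} → ℤX.sym {num f *ᴾ den g} {num g *ᴾ den f}
  ; trans       = λ {f} {g} {h} f≈g g≈h → *ᴾ-cancelˡ (den g) _ _ (den≉0 g)
      (≈ᶠ-trans {num f} {den f} {num g} {den g} {num h} {den h} f≈g g≈h)
  ; +-cong      = λ {f} {f′} {g} {g′} →
      +ᶠ-cong {num f} {den f} {num f′} {den f′} {num g} {den g} {num g′} {den g′}
  ; *-cong      = λ {f} {f′} {g} {g′} →
      *ᶠ-cong {num f} {den f} {num f′} {den f′} {num g} {den g} {num g′} {den g′}
  ; -‿cong      = λ {f} {f′} → -ᶠ-cong {num f} {den f} {num f′} {den f′}
  ; +-assoc     = λ f g h → +ᶠ-assoc (num f) (den f) (num g) (den g) (num h) (den h)
  ; +-comm      = λ f g → +ᶠ-comm (num f) (den f) (num g) (den g)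
  ; +-identityˡ = λ f → +ᶠ-identityˡ (num f) (den f)
  ; -‿inverseˡ  = λ f → -ᶠ-inverseˡ (num f) (den f)
  ; *-assoc     = λ f g h → *ᶠ-assoc (num f) (den f) (num g) (den g) (num h) (den h)
  ; *-comm      = λ f g → *ᶠ-comm (num f) (den f) (num g) (den g)
  ; *-identityˡ = λ f → *ᶠ-identityˡ (num f) (den f)
  ; distribʳ    = λ f g h → *ᶠ-distribʳ (num f) (den f) (num g) (den g) (num h) (den h)
  }
  where open Fractions polyRing

module ℚX = CommutativeRing ratFunRing

divide-cancel : ∀ f g (g≉0 : ¬ g ℚX.≈ 0ᴿ) → divide f g g≉0 *ᴿ g ℚX.≈ f
divide-cancel f g g≉0 = Fractions./ᶠ-cancel polyRing (num f) (den f) (num g) (den g)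

*ᴿ-cancelʳ : ∀ f g h → ¬ h ℚX.≈ 0ᴿ → f *ᴿ h ℚX.≈ g *ᴿ h → f ℚX.≈ g
*ᴿ-cancelʳ f g h h≉0 =
  *-cancelʳ-unit ratFunRing {divide 1ᴿ h h≉0} {h} (divide-cancel 1ᴿ h h≉0) f g

fromPoly-homo : IsRingHomomorphism polyRawRing ratFunRawRing fromPoly
fromPoly-homo = HomomorphismLaws.isRingHomomorphism record
  { cong    = λ {p} {q} → ℤX.*-congʳ {1ᴾ} {p} {q}
  ; +-homo  = λ p q → ℤX.*-cong {p +ᴾ q} {p *ᴾ 1ᴾ +ᴾ q *ᴾ 1ᴾ}
      (ℤX.+-cong {p} {p *ᴾ 1ᴾ} {q} {q *ᴾ 1ᴾ}
        (ℤX.sym {p *ᴾ 1ᴾ} {p} (ℤX.*-identityʳ p)) (ℤX.sym {q *ᴾ 1ᴾ} {q} (ℤX.*-identityʳ q)))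
      (ℤX.*-identityʳ 1ᴾ)
  ; *-homo  = λ p q → ℤX.*-congˡ {p *ᴾ q} (ℤX.*-identityʳ 1ᴾ)
  ; -‿homo  = λ p → ℤX.refl {(-ᴾ p) *ᴾ 1ᴾ}
  ; 0#-homo = ℤX.refl {0ᴾ}
  ; 1#-homo = ℤX.refl {1ᴾ *ᴾ 1ᴾ}
  }

-- Evaluation of polynomials

module Horner (S : CommutativeRing 0ℓ 0ℓ) (ι : ℤ → CommutativeRing.Carrier S)
  (ι-homo : IsRingHomomorphism (CommutativeRing.rawRing ℤ-ring) (CommutativeRing.rawRing S) ι)
  (r : CommutativeRing.Carrier S) where
  open CommutativeRing S
  open import Algebra.Properties.Ring ring using (-‿distribˡ-*; -‿distribʳ-*; -‿+-comm; -0#≈0#)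
  open import Algebra.Solver.Ring.NaturalCoefficients.Default commutativeSemiring
    using (solve; _:+_; _:*_; _:=_)
  open import Relation.Binary.Reasoning.Setoid setoid
  open IsRingHomomorphism ι-homo using ()
    renaming (+-homo to ι-+; *-homo to ι-*; -‿homo to ι-neg; 0#-homo to ι-0; 1#-homo to ι-1)

  -- Over ℚ(λ) this has the clauses of `eval`; over ℤ it gives the values at -1 and 0 by which
  -- polynomials are seen to be nonzero.
  ⟪_⟫ : Poly → Carrier
  ⟪ []    ⟫ = 0#
  ⟪ a ∷ p ⟫ = ι a + r * ⟪ p ⟫

  ι-cong : ∀ {a b} → a ≡ b → ι a ≈ ι b
  ι-cong ≡.refl = refl

  0+r*0 : ∀ {x y} → x ≈ 0# → y ≈ 0# → x + r * y ≈ 0#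
  0+r*0 x≈0 y≈0 = trans (+-cong x≈0 (trans (*-congˡ y≈0) (zeroʳ r))) (+-identityˡ 0#)

  ⟪⟫-zero : ∀ p → p ≈ᴾ 0ᴾ → ⟪ p ⟫ ≈ 0#
  ⟪⟫-zero []      _   = refl
  ⟪⟫-zero (a ∷ p) p≈0 = 0+r*0 (trans (ι-cong (p≈0 0)) ι-0) (⟪⟫-zero p λ k → p≈0 (ℕ.suc k))

  ⟪⟫-cong : ∀ p q → p ≈ᴾ q → ⟪ p ⟫ ≈ ⟪ q ⟫
  ⟪⟫-cong p       []      p≈q = ⟪⟫-zero p p≈q
  ⟪⟫-cong []      (b ∷ q) p≈q = sym (⟪⟫-zero (b ∷ q) λ k → ≡.sym (p≈q k))
  ⟪⟫-cong (a ∷ p) (b ∷ q) p≈q =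
    +-cong (ι-cong (p≈q 0)) (*-congˡ (⟪⟫-cong p q λ k → p≈q (ℕ.suc k)))

  ⟪⟫-+ : ∀ p q → ⟪ p +ᴾ q ⟫ ≈ ⟪ p ⟫ + ⟪ q ⟫
  ⟪⟫-+ []      q       = sym (+-identityˡ _)
  ⟪⟫-+ (a ∷ p) []      = sym (+-identityʳ _)
  ⟪⟫-+ (a ∷ p) (b ∷ q) = trans (+-cong (ι-+ a b) (*-congˡ (⟪⟫-+ p q)))
    (solve 5 (λ a b r x y → (a :+ b) :+ r :* (x :+ y) := (a :+ r :* x) :+ (b :+ r :* y)) refl
      (ι a) (ι b) r ⟪ p ⟫ ⟪ q ⟫)

  ⟪⟫-· : ∀ a p → ⟪ a ·ᴾ p ⟫ ≈ ι a * ⟪ p ⟫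
  ⟪⟫-· a []      = sym (zeroʳ (ι a))
  ⟪⟫-· a (b ∷ p) = trans (+-cong (ι-* a b) (*-congˡ (⟪⟫-· a p)))
    (solve 4 (λ a b r x → a :* b :+ r :* (a :* x) := a :* (b :+ r :* x)) refl (ι a) (ι b) r ⟪ p ⟫)

  ⟪⟫-* : ∀ p q → ⟪ p *ᴾ q ⟫ ≈ ⟪ p ⟫ * ⟪ q ⟫
  ⟪⟫-* []      q = sym (zeroˡ ⟪ q ⟫)
  ⟪⟫-* (a ∷ p) q = begin
    ⟪ a ·ᴾ q +ᴾ (0ℤ ∷ p *ᴾ q) ⟫
      ≈⟨ ⟪⟫-+ (a ·ᴾ q) (0ℤ ∷ p *ᴾ q) ⟩
    ⟪ a ·ᴾ q ⟫ + (ι 0ℤ + r * ⟪ p *ᴾ q ⟫)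
      ≈⟨ +-cong (⟪⟫-· a q) (trans (+-cong ι-0 (*-congˡ (⟪⟫-* p q))) (+-identityˡ _)) ⟩
    ι a * ⟪ q ⟫ + r * (⟪ p ⟫ * ⟪ q ⟫)
      ≈⟨ solve 4 (λ a r x y → a :* y :+ r :* (x :* y) := (a :+ r :* x) :* y) refl (ι a) r ⟪ p ⟫ ⟪ q ⟫ ⟩
    (ι a + r * ⟪ p ⟫) * ⟪ q ⟫ ∎

  ⟪⟫-neg : ∀ p → ⟪ -ᴾ p ⟫ ≈ - ⟪ p ⟫
  ⟪⟫-neg []      = sym -0#≈0#
  ⟪⟫-neg (a ∷ p) = trans
    (+-cong (ι-neg a) (trans (*-congˡ (⟪⟫-neg p)) (sym (-‿distribʳ-* r ⟪ p ⟫))))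
    (-‿+-comm (ι a) (r * ⟪ p ⟫))

  ⟪constᴾ⟫ : ∀ a → ⟪ constᴾ a ⟫ ≈ ι a
  ⟪constᴾ⟫ a = trans (+-congˡ (zeroʳ r)) (+-identityʳ (ι a))

  ⟪Xᴾ⟫ : ⟪ Xᴾ ⟫ ≈ r
  ⟪Xᴾ⟫ = trans (+-cong ι-0 (trans (*-congˡ (trans (⟪constᴾ⟫ 1ℤ) ι-1)) (*-identityʳ r))) (+-identityˡ r)

  ⟪⟫-homo : IsRingHomomorphism polyRawRing rawRing ⟪_⟫
  ⟪⟫-homo = HomomorphismLaws.isRingHomomorphism record
    { cong    = λ {p} {q} → ⟪⟫-cong p q
    ; +-homo  = ⟪⟫-+
    ; *-homo  = ⟪⟫-*
    ; -‿homo  = ⟪⟫-neg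
    ; 0#-homo = refl
    ; 1#-homo = trans (⟪constᴾ⟫ 1ℤ) ι-1
    }

id-homo : IsRingHomomorphism (CommutativeRing.rawRing ℤ-ring) (CommutativeRing.rawRing ℤ-ring) (λ a → a)
id-homo = HomomorphismLaws.isRingHomomorphism record
  { cong = λ a≡b → a≡b ; +-homo = λ _ _ → ≡.refl ; *-homo = λ _ _ → ≡.refl
  ; -‿homo = λ _ → ≡.refl ; 0#-homo = ≡.refl ; 1#-homo = ≡.refl }

constᴾ-homo : IsRingHomomorphism (CommutativeRing.rawRing ℤ-ring) polyRawRing constᴾ
constᴾ-homo = HomomorphismLaws.isRingHomomorphism record
  { cong    = λ { ≡.refl k → ≡.refl }
  ; +-homo  = λ _ _ _ → ≡.refl
  ; *-homo  = λ { a b ℕ.zero → ≡.sym (ℤ.+-identityʳ (a ℤ.* b)) ; a b (ℕ.suc k) → ≡.refl }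
  ; -‿homo  = λ _ _ → ≡.refl
  ; 0#-homo = λ { ℕ.zero → ≡.refl ; (ℕ.suc k) → ≡.refl }
  ; 1#-homo = λ _ → ≡.refl
  }

const-homo : IsRingHomomorphism (CommutativeRing.rawRing ℤ-ring) ratFunRawRing Defs.const
const-homo = Composition.isRingHomomorphism (λ {f} {g} {h} → ℚX.trans {f} {g} {h}) constᴾ-homo fromPoly-homo

eval-homo : ∀ r → IsRingHomomorphism polyRawRing ratFunRawRing λ p → eval p r
eval-homo r = HomomorphismLaws.isRingHomomorphism record
  { cong    = λ {p} {q} p≈q → transport (p≡ p) (p≡ q) (⟪⟫-cong p q p≈q)
  ; +-homo  = λ p q → transport (p≡ (p +ᴾ q)) (≡.cong₂ _+ᴿ_ (p≡ p) (p≡ q)) (⟪⟫-+ p q)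
  ; *-homo  = λ p q → transport (p≡ (p *ᴾ q)) (≡.cong₂ _*ᴿ_ (p≡ p) (p≡ q)) (⟪⟫-* p q)
  ; -‿homo  = λ p → transport (p≡ (-ᴾ p)) (≡.cong ℚX.-_ (p≡ p)) (⟪⟫-neg p)
  ; 0#-homo = ℚX.refl {0ᴿ}
  ; 1#-homo = IsRingHomomorphism.1#-homo ⟪⟫-homo
  }
  where
  open Horner ratFunRing Defs.const const-homo r
  -- `eval` and `⟪_⟫` are distinct functions, equal only by induction on the list; that is why the
  -- laws for arbitrary lists are transported.
  p≡ : ∀ p → ⟪ p ⟫ ≡ eval p r
  p≡ []      = ≡.refl
  p≡ (a ∷ p) = ≡.cong (λ f → Defs.const a +ᴿ r *ᴿ f) (p≡ p)
  transport : ∀ {f f′ g g′} → f ≡ f′ → g ≡ g′ → f ℚX.≈ g → f′ ℚX.≈ g′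
  transport ≡.refl ≡.refl f≈g = f≈g

-- The point -2/(λ+1) has a pole at λ = -1, so the value of p there has one
-- unless p is constant; some representation has numerator nonzero at λ = -1.

open Horner ℤ-ring (λ a → a) id-homo -1ℤ using ()
  renaming (⟪_⟫ to ⟪_⟫₋₁; ⟪⟫-cong to ⟪⟫₋₁-cong; ⟪⟫-+ to ⟪⟫₋₁-+; ⟪⟫-* to ⟪⟫₋₁-*; ⟪constᴾ⟫ to ⟪constᴾ⟫₋₁)

data NonzeroLast : Poly → Set where
  [_] : ∀ {a} → a ≢ 0ℤ → NonzeroLast (a ∷ [])
  _∷_ : ∀ a {p} → NonzeroLast p → NonzeroLast (a ∷ p)

≈0? : ∀ p → Dec (p ≈ᴾ 0ᴾ)
≈0? []      = yes λ _ → ≡.refl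
≈0? (a ∷ p) with a ℤ.≟ 0ℤ | ≈0? p
... | yes a≡0 | yes p≈0 = yes (zero-tail a≡0 p≈0)
... | yes _   | no  p≉0 = no λ ap≈0 → p≉0 λ k → ap≈0 (ℕ.suc k)
... | no  a≢0 | _       = no λ ap≈0 → a≢0 (ap≈0 0)

strip : ∀ p → ¬ p ≈ᴾ 0ᴾ → ∃ λ q → NonzeroLast q × p ≈ᴾ q
strip []      p≉0 = ⊥-elim (p≉0 λ _ → ≡.refl)
strip (a ∷ p) ap≉0 with ≈0? p
... | yes p≈0 = a ∷ [] , [ (λ a≡0 → ap≉0 (zero-tail a≡0 p≈0)) ] ,
                λ { ℕ.zero → ≡.refl ; (ℕ.suc k) → p≈0 k }
... | no  p≉0 with strip p p≉0
...   | q , last , p≈q = a ∷ q , a ∷ last , λ { ℕ.zero → ≡.refl ; (ℕ.suc k) → p≈q k }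

-- If g represents the value of the tail, the next numerator is a (λ+1) den g - 2 num g, which at λ
-- = -1 equals -2 times the numerator of g there. Starting from a nonzero leading coefficient, the
-- numerators thus stay nonzero at -1.
eval-representative : ∀ {p} → NonzeroLast p →
  ∃ λ f → eval p -2/⟨λ+1⟩ ℚX.≈ f × ⟪ num f ⟫₋₁ ≢ 0ℤ
eval-representative ([_] {a} a≢0) =
  -- The literal value of a one-term list is a + r · 0 over the denominator λ+1, so its numerator
  -- vanishes at λ = -1; the representative `const a` avoids this.
  Defs.const a , constant ratFunRing (Defs.const a) -2/⟨λ+1⟩ , λ eq → a≢0 (≡.trans (≡.sym (⟪constᴾ⟫₋₁ a)) eq)
  where
  constant : (S : CommutativeRing 0ℓ 0ℓ) → let open CommutativeRing S in ∀ x y → x + y * 0# ≈ x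
  constant S x y = trans (+-congˡ (zeroʳ y)) (+-identityʳ x)
    where open CommutativeRing S
eval-representative (_∷_ a {p} last) with eval-representative last
... | g , p≈g , g₋₁≢0 = f , ℚX.+-congˡ {Defs.const a} { -2/⟨λ+1⟩ *ᴿ eval p -2/⟨λ+1⟩} { -2/⟨λ+1⟩ *ᴿ g}
                              (ℚX.*-congˡ { -2/⟨λ+1⟩} {eval p -2/⟨λ+1⟩} {g} p≈g) , f₋₁≢0
  where
  f : RatFun
  f = Defs.const a +ᴿ -2/⟨λ+1⟩ *ᴿ g
  value : ⟪ num f ⟫₋₁ ≡ (ℤ.- (ℤ.+ 2)) ℤ.* ⟪ num g ⟫₋₁
  value = begin
    ⟪ constᴾ a *ᴾ (X+1 *ᴾ den g) +ᴾ (constᴾ (ℤ.- (ℤ.+ 2)) *ᴾ num g) *ᴾ 1ᴾ ⟫₋₁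
      ≡⟨ ⟪⟫₋₁-+ (constᴾ a *ᴾ (X+1 *ᴾ den g)) _ ⟩
    ⟪ constᴾ a *ᴾ (X+1 *ᴾ den g) ⟫₋₁ ℤ.+ ⟪ (constᴾ (ℤ.- (ℤ.+ 2)) *ᴾ num g) *ᴾ 1ᴾ ⟫₋₁
      ≡⟨ ≡.cong₂ ℤ._+_
           (≡.trans (⟪⟫₋₁-* (constᴾ a) (X+1 *ᴾ den g)) (≡.trans
             (≡.cong (⟪ constᴾ a ⟫₋₁ ℤ.*_) (⟪⟫₋₁-* X+1 (den g))) (ℤ.*-zeroʳ ⟪ constᴾ a ⟫₋₁)))
           (≡.trans (⟪⟫₋₁-* (constᴾ (ℤ.- (ℤ.+ 2)) *ᴾ num g) 1ᴾ) (≡.trans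
             (ℤ.*-identityʳ _) (⟪⟫₋₁-* (constᴾ (ℤ.- (ℤ.+ 2))) (num g)))) ⟩
    0ℤ ℤ.+ (ℤ.- (ℤ.+ 2)) ℤ.* ⟪ num g ⟫₋₁
      ≡⟨ ℤ.+-identityˡ _ ⟩
    (ℤ.- (ℤ.+ 2)) ℤ.* ⟪ num g ⟫₋₁ ∎
    where open ≡.≡-Reasoning
  f₋₁≢0 : ⟪ num f ⟫₋₁ ≢ 0ℤ
  f₋₁≢0 f₋₁≡0 = [ (λ ()) , g₋₁≢0 ]′ (ℤ.i*j≡0⇒i≡0∨j≡0 (ℤ.- (ℤ.+ 2)) (≡.trans (≡.sym value) f₋₁≡0))

-- In effect -2/(λ+1) is transcendental over ℚ, so every rational form of the walk series can be
-- evaluated there, whatever its denominator. A zero value would make the numerator of its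
-- representative zero, against its value at -1.
eval-nonzero : ∀ p → ¬ p ≈ᴾ 0ᴾ → ¬ eval p -2/⟨λ+1⟩ ℚX.≈ 0ᴿ
eval-nonzero p p≉0 p⟨r⟩≈0 with strip p p≉0
... | q , last , p≈q with eval-representative last
...   | f , q⟨r⟩≈f , f₋₁≢0 = f₋₁≢0 (begin
  ⟪ num f ⟫₋₁                ≡⟨ ℤ.*-identityʳ _ ⟨
  ⟪ num f ⟫₋₁ ℤ.* 1ℤ         ≡⟨ ⟪⟫₋₁-* (num f) 1ᴾ ⟨
  ⟪ num f *ᴾ 1ᴾ ⟫₋₁          ≡⟨ ⟪⟫₋₁-cong (num f *ᴾ 1ᴾ) 0ᴾ f≈0 ⟩
  0ℤ                         ∎)
  where
  open ≡.≡-Reasoning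
  f≈0 : f ℚX.≈ 0ᴿ
  f≈0 = ℚX.trans {f} {eval q -2/⟨λ+1⟩} {0ᴿ} (ℚX.sym {eval q -2/⟨λ+1⟩} {f} q⟨r⟩≈f)
    (ℚX.trans {eval q -2/⟨λ+1⟩} {eval p -2/⟨λ+1⟩} {0ᴿ}
      (IsRingHomomorphism.⟦⟧-cong (eval-homo -2/⟨λ+1⟩) {q} {p} (λ k → ≡.sym (p≈q k))) p⟨r⟩≈0)

-- Counting walks

𝟙 : {P : Set} → Dec P → ℤ
𝟙 P? = if does P? then 1ℤ else 0ℤ

𝟙-× : {P Q : Set} (P? : Dec P) (Q? : Dec Q) → 𝟙 (P? ×-dec Q?) ≡ 𝟙 P? ℤ.* 𝟙 Q?
𝟙-× P? Q? with does P?
... | true  = ≡.sym (ℤ.*-identityˡ (𝟙 Q?))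
... | false = ≡.refl

module _ {A : Set} where

  Σᴸ : (A → ℤ) → List A → ℤ
  Σᴸ f []       = 0ℤ
  Σᴸ f (x ∷ xs) = f x ℤ.+ Σᴸ f xs

  Σᴸ-cong : ∀ {f g} → (∀ x → f x ≡ g x) → ∀ xs → Σᴸ f xs ≡ Σᴸ g xs
  Σᴸ-cong f≗g []       = ≡.refl
  Σᴸ-cong f≗g (x ∷ xs) = ≡.cong₂ ℤ._+_ (f≗g x) (Σᴸ-cong f≗g xs)

  Σᴸ-*ˡ : ∀ a f xs → Σᴸ (λ x → a ℤ.* f x) xs ≡ a ℤ.* Σᴸ f xs
  Σᴸ-*ˡ a f []       = ≡.sym (ℤ.*-zeroʳ a)
  Σᴸ-*ˡ a f (x ∷ xs) = ≡.trans (≡.cong (λ z → a ℤ.* f x ℤ.+ z) (Σᴸ-*ˡ a f xs))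
    (≡.sym (ℤ.*-distribˡ-+ a (f x) (Σᴸ f xs)))

  Σᴸ-++ : ∀ f xs ys → Σᴸ f (xs List.++ ys) ≡ Σᴸ f xs ℤ.+ Σᴸ f ys
  Σᴸ-++ f []       ys = ≡.sym (ℤ.+-identityˡ _)
  Σᴸ-++ f (x ∷ xs) ys = ≡.trans (≡.cong (λ z → f x ℤ.+ z) (Σᴸ-++ f xs ys)) (≡.sym (ℤ.+-assoc (f x) _ _))

  Σᴸ-sum-comm : ∀ {n} (f : A → Fin n → ℤ) xs →
    Σᴸ (λ x → ℤΣ.sum (f x)) xs ≡ ℤΣ.sum (λ j → Σᴸ (λ x → f x j) xs)
  Σᴸ-sum-comm {n} f [] = ≡.sym (sum-replicate-zero n)
  Σᴸ-sum-comm f (x ∷ xs) = ≡.trans (≡.cong (λ z → ℤΣ.sum (f x) ℤ.+ z) (Σᴸ-sum-comm f xs))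
    (≡.sym (∑-distrib-+ (f x) (λ j → Σᴸ (λ x → f x j) xs)))

  Σᴸ-tabulate : ∀ {n} f (g : Fin n → A) → Σᴸ f (List.tabulate g) ≡ ℤΣ.sum (λ i → f (g i))
  Σᴸ-tabulate {ℕ.zero}  f g = ≡.refl
  Σᴸ-tabulate {ℕ.suc n} f g = ≡.cong (λ z → f (g 0F) ℤ.+ z) (Σᴸ-tabulate f (g ∘ Fin.suc))

  length-filter : {P : A → Set} (P? : ∀ x → Dec (P x)) → ∀ xs →
    ℤ.+ List.length (List.filter P? xs) ≡ Σᴸ (λ x → 𝟙 (P? x)) xs
  length-filter P? []       = ≡.refl
  length-filter P? (x ∷ xs) with does (P? x)
  ... | true  = ≡.cong (λ z → 1ℤ ℤ.+ z) (length-filter P? xs)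
  ... | false = ≡.trans (length-filter P? xs) (≡.sym (ℤ.+-identityˡ _))

Σᴸ-map : {A B : Set} (f : B → ℤ) (g : A → B) → ∀ xs → Σᴸ f (List.map g xs) ≡ Σᴸ (λ x → f (g x)) xs
Σᴸ-map f g []       = ≡.refl
Σᴸ-map f g (x ∷ xs) = ≡.cong (λ z → f (g x) ℤ.+ z) (Σᴸ-map f g xs)

Σᴸ-cartesianProductWith : {A B C : Set} (f : C → ℤ) (g : A → B → C) → ∀ xs ys →
  Σᴸ f (List.cartesianProductWith g xs ys) ≡ Σᴸ (λ x → Σᴸ (λ y → f (g x y)) ys) xs
Σᴸ-cartesianProductWith f g []       ys = ≡.refl
Σᴸ-cartesianProductWith f g (x ∷ xs) ys = ≡.trans
  (Σᴸ-++ f (List.map (g x) ys) (List.cartesianProductWith g xs ys))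
  (≡.cong₂ ℤ._+_ (Σᴸ-map f (g x) ys) (Σᴸ-cartesianProductWith f g xs ys))

-- Walks and the adjacency matrix

module _ {n} (G : Hypergraph n) where

  walksFrom : ℕ → Fin n → ℤ
  walksFrom l i = Σᴸ (λ s → 𝟙 (isWalk? i s)) (allSteps G l)

  walkSeries-sum : ∀ l → walkSeries G l ≡ ℤΣ.sum (walksFrom l)
  walkSeries-sum l = begin
    walkSeries G l
      ≡⟨ length-filter (λ ws → isWalk? (proj₁ ws) (proj₂ ws)) (List.cartesianProduct (List.allFin n) (allSteps G l)) ⟩
    Σᴸ (λ ws → 𝟙 (isWalk? (proj₁ ws) (proj₂ ws))) (List.cartesianProduct (List.allFin n) (allSteps G l))
      ≡⟨ Σᴸ-cartesianProductWith _ _,_ (List.allFin n) (allSteps G l) ⟩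
    Σᴸ (walksFrom l) (List.allFin n)
      ≡⟨ Σᴸ-tabulate (walksFrom l) id ⟩
    ℤΣ.sum (walksFrom l) ∎
    where open ≡.≡-Reasoning

  incidence : Fin n → Fin n → Subset n → ℤ
  incidence i j e = 𝟙 (i ∈? e) ℤ.* 𝟙 (j ∈? e)

  -- `adjacency` tests the inclusion of a pair, `IsWalk` two memberships; the product of indicators
  -- is their common form.
  𝟙-pair⊆ : ∀ i j e → 𝟙 ((⁅ i ⁆ ∪ ⁅ j ⁆) ⊆? e) ≡ incidence i j e
  𝟙-pair⊆ i j e = ≡.trans
    (≡.cong (λ b → if b then 1ℤ else 0ℤ) (does-⇔ (mk⇔ to from) ((⁅ i ⁆ ∪ ⁅ j ⁆) ⊆? e) ((i ∈? e) ×-dec (j ∈? e))))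
    (𝟙-× (i ∈? e) (j ∈? e))
    where
    to : (⁅ i ⁆ ∪ ⁅ j ⁆) ⊆ e → (i ∈ e) × (j ∈ e)
    to ij⊆e = ij⊆e (x∈p∪q⁺ (inj₁ (x∈⁅x⁆ i))) , ij⊆e (x∈p∪q⁺ (inj₂ (x∈⁅x⁆ j)))
    from : (i ∈ e) × (j ∈ e) → (⁅ i ⁆ ∪ ⁅ j ⁆) ⊆ e
    from (i∈e , j∈e) k∈ij with x∈p∪q⁻ ⁅ i ⁆ ⁅ j ⁆ k∈ij
    ... | inj₁ k∈i = ≡.subst (_∈ e) (≡.sym (x∈⁅y⁆⇒x≡y i k∈i)) i∈e
    ... | inj₂ k∈j = ≡.subst (_∈ e) (≡.sym (x∈⁅y⁆⇒x≡y j k∈j)) j∈e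

  -- The first factor absorbs the zero diagonal and matches the condition that consecutive vertices
  -- of a walk differ.
  adjacency-sum : ∀ i j → adjacency G i j ≡ 𝟙 (¬? (i ≟ᶠ j)) ℤ.* Σᴸ (incidence i j) (edges G)
  adjacency-sum i j with does (i ≟ᶠ j)
  ... | true  = ≡.refl
  ... | false = ≡.trans (length-filter (λ e → (⁅ i ⁆ ∪ ⁅ j ⁆) ⊆? e) (edges G))
    (≡.trans (Σᴸ-cong (𝟙-pair⊆ i j) (edges G)) (≡.sym (ℤ.*-identityˡ _)))

  adjacency-symmetric : ∀ i j → adjacency G i j ≡ adjacency G j i
  adjacency-symmetric i j = begin
    adjacency G i j
      ≡⟨ adjacency-sum i j ⟩
    𝟙 (¬? (i ≟ᶠ j)) ℤ.* Σᴸ (incidence i j) (edges G)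
      ≡⟨ ≡.cong₂ ℤ._*_
           (≡.cong (λ b → if b then 1ℤ else 0ℤ) (does-⇔ (mk⇔ (_∘ ≡.sym) (_∘ ≡.sym)) (¬? (i ≟ᶠ j)) (¬? (j ≟ᶠ i))))
           (Σᴸ-cong (λ e → ℤ.*-comm (𝟙 (i ∈? e)) (𝟙 (j ∈? e))) (edges G)) ⟩
    𝟙 (¬? (j ≟ᶠ i)) ℤ.* Σᴸ (incidence j i) (edges G)
      ≡⟨ adjacency-sum j i ⟨
    adjacency G j i ∎
    where open ≡.≡-Reasoning

  -- Splitting off the first step gives a sum over the next vertex j, weighted by the entry (i, j).
  -- Symmetry turns this into the entry (j, i), so that the recursion is the row vector product wA.
  walksFrom-suc : ∀ l i → walksFrom (ℕ.suc l) i ≡ ℤΣ.sum (λ j → walksFrom l j ℤ.* adjacency G j i)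
  walksFrom-suc l i = begin
    walksFrom (ℕ.suc l) i
      ≡⟨ Σᴸ-cartesianProductWith (λ s → 𝟙 (isWalk? i s)) Vec._∷_
           (List.cartesianProduct (edges G) (List.allFin n)) (allSteps G l) ⟩
    Σᴸ (λ { (e , j) → Σᴸ (λ s → 𝟙 (isWalk? i ((e , j) Vec.∷ s))) (allSteps G l) })
      (List.cartesianProduct (edges G) (List.allFin n))
      ≡⟨ Σᴸ-cong (λ { (e , j) → step e j }) (List.cartesianProduct (edges G) (List.allFin n)) ⟩
    Σᴸ (λ { (e , j) → weight j ℤ.* incidence i j e }) (List.cartesianProduct (edges G) (List.allFin n))
      ≡⟨ Σᴸ-cartesianProductWith _ _,_ (edges G) (List.allFin n) ⟩
    Σᴸ (λ e → Σᴸ (λ j → weight j ℤ.* incidence i j e) (List.allFin n)) (edges G)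
      ≡⟨ Σᴸ-cong (λ e → Σᴸ-tabulate (λ j → weight j ℤ.* incidence i j e) id) (edges G) ⟩
    Σᴸ (λ e → ℤΣ.sum (λ j → weight j ℤ.* incidence i j e)) (edges G)
      ≡⟨ Σᴸ-sum-comm (λ e j → weight j ℤ.* incidence i j e) (edges G) ⟩
    ℤΣ.sum (λ j → Σᴸ (λ e → weight j ℤ.* incidence i j e) (edges G))
      ≡⟨ sum-cong-≗ collect ⟩
    ℤΣ.sum (λ j → walksFrom l j ℤ.* adjacency G j i) ∎
    where
    open ≡.≡-Reasoning
    weight : Fin n → ℤ
    weight j = walksFrom l j ℤ.* 𝟙 (¬? (i ≟ᶠ j))
    step : ∀ e j → Σᴸ (λ s → 𝟙 (isWalk? i ((e , j) Vec.∷ s))) (allSteps G l) ≡ weight j ℤ.* incidence i j e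
    step e j = begin
      Σᴸ (λ s → 𝟙 (isWalk? i ((e , j) Vec.∷ s))) (allSteps G l)
        ≡⟨ Σᴸ-cong (λ s → ≡.trans (𝟙-× (¬? (i ≟ᶠ j)) ((i ∈? e) ×-dec ((j ∈? e) ×-dec isWalk? j s)))
             (≡.trans (≡.cong (λ z → 𝟙 (¬? (i ≟ᶠ j)) ℤ.* z)
               (≡.trans (𝟙-× (i ∈? e) ((j ∈? e) ×-dec isWalk? j s))
                 (≡.trans (≡.cong (λ z → 𝟙 (i ∈? e) ℤ.* z) (𝟙-× (j ∈? e) (isWalk? j s)))
                   (≡.sym (ℤ.*-assoc (𝟙 (i ∈? e)) (𝟙 (j ∈? e)) (𝟙 (isWalk? j s)))))))
               (≡.sym (ℤ.*-assoc (𝟙 (¬? (i ≟ᶠ j))) (incidence i j e) (𝟙 (isWalk? j s))))))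
             (allSteps G l) ⟩
      Σᴸ (λ s → (𝟙 (¬? (i ≟ᶠ j)) ℤ.* incidence i j e) ℤ.* 𝟙 (isWalk? j s)) (allSteps G l)
        ≡⟨ Σᴸ-*ˡ (𝟙 (¬? (i ≟ᶠ j)) ℤ.* incidence i j e) (λ s → 𝟙 (isWalk? j s)) (allSteps G l) ⟩
      (𝟙 (¬? (i ≟ᶠ j)) ℤ.* incidence i j e) ℤ.* walksFrom l j
        ≡⟨ ℤ.*-comm _ (walksFrom l j) ⟩
      walksFrom l j ℤ.* (𝟙 (¬? (i ≟ᶠ j)) ℤ.* incidence i j e)
        ≡⟨ ℤ.*-assoc (walksFrom l j) _ _ ⟨
      weight j ℤ.* incidence i j e ∎
    collect : ∀ j → Σᴸ (λ e → weight j ℤ.* incidence i j e) (edges G) ≡ walksFrom l j ℤ.* adjacency G j i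
    collect j = begin
      Σᴸ (λ e → weight j ℤ.* incidence i j e) (edges G)
        ≡⟨ Σᴸ-*ˡ (weight j) (incidence i j) (edges G) ⟩
      weight j ℤ.* Σᴸ (incidence i j) (edges G)
        ≡⟨ ℤ.*-assoc (walksFrom l j) _ _ ⟩
      walksFrom l j ℤ.* (𝟙 (¬? (i ≟ᶠ j)) ℤ.* Σᴸ (incidence i j) (edges G))
        ≡⟨ ≡.cong (λ z → walksFrom l j ℤ.* z) (≡.trans (≡.sym (adjacency-sum i j)) (adjacency-symmetric i j)) ⟩
      walksFrom l j ℤ.* adjacency G j i ∎

-2ℤ : ℤ
-2ℤ = ℤ.- (+ 2)

-- Characteristic polynomials under a homomorphism

module Characteristic (F : CommutativeRing 0ℓ 0ℓ) (ι : ℤ → CommutativeRing.Carrier F)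
  (ι-homo : IsRingHomomorphism (CommutativeRing.rawRing ℤ-ring) (CommutativeRing.rawRing F) ι) where
  open CommutativeRing F
  open Determinant F
  open import Algebra.Properties.Semiring.Exp semiring using () renaming (_^_ to _^ᶠ_)
  open import Relation.Binary.Reasoning.Setoid setoid
  open IsRingHomomorphism ι-homo using ()
    renaming (⟦⟧-cong to ι-cong; +-homo to ι-+; *-homo to ι-*; -‿homo to ι-neg; 0#-homo to ι-0; 1#-homo to ι-1)

  ι-almostCommutative : CommutativeRing.rawRing ℤ-ring -Raw-AlmostCommutative⟶ fromCommutativeRing F
  ι-almostCommutative = record
    { ⟦_⟧ = ι ; +-homo = ι-+ ; *-homo = ι-* ; -‿homo = ι-neg ; 0-homo = ι-0 ; 1-homo = ι-1 }

  ι-≟ : ∀ a b → Maybe (ι a ≈ ι b)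
  ι-≟ a b = map ι-cong (dec⇒weaklyDec ℤ._≟_ a b)

  open Algebra.Solver.Ring (CommutativeRing.rawRing ℤ-ring) (fromCommutativeRing F) ι-almostCommutative ι-≟
    using (solve; con; _:+_; _:*_; :-_; _:=_)

  characteristic : ∀ {n} → Carrier → Matrix ℤ n → Carrier
  characteristic x M = det λ i j → x * identity _ i j + - ι (M i j)

  characteristic-cong : ∀ {x y} → x ≈ y → ∀ {n} (M : Matrix ℤ n) → characteristic x M ≈ characteristic y M
  characteristic-cong x≈y {n} M = det-cong λ i j → +-congʳ { - ι (M i j)} (*-congʳ {identity n i j} x≈y)

  -- One statement covers both characteristic polynomials: `fromPoly` yields P_S at λ, and `eval`
  -- yields P_A at -(λ+1)/2.
  charPoly-homo : ∀ {φ : Poly → Carrier} → IsRingHomomorphism polyRawRing rawRing φ →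
    (∀ a → φ (constᴾ a) ≈ ι a) → ∀ {n} (M : Matrix ℤ n) →
    φ (charPoly M) ≈ characteristic (φ Xᴾ) M
  charPoly-homo {φ} φ-homo φ-const {n} M = trans
    (det-homo {polyRing} {F} φ-homo λ i j → (Xᴾ *ᴾ ℤXΔ.identity n i j) +ᴾ (-ᴾ constᴾ (M i j)))
    (det-cong λ i j → trans (+-homo (Xᴾ *ᴾ ℤXΔ.identity n i j) (-ᴾ constᴾ (M i j))) (+-cong
      (trans (*-homo Xᴾ (ℤXΔ.identity n i j)) (*-congˡ (identity-homo {polyRing} {F} φ-homo i j)))
      (trans (-‿homo (constᴾ (M i j))) (-‿cong (φ-const (M i j))))))
    where
    open IsRingHomomorphism φ-homo
    module ℤXΔ = Determinant polyRing

  -- Here x is λ, u is -1/(λ+1), r is -2/(λ+1), m is -(λ+1)/2 and h is the value of H at r. Three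
  -- relations with λ+1 are all that the computation needs of the first four, so it stays in an
  -- abstract ring, free of fractions.
  module _ {n} (G : Hypergraph n) {x u r m h : Carrier}
    (μu≈-1 : (x + 1#) * u ≈ ι -1ℤ) (μr≈-2 : (x + 1#) * r ≈ ι -2ℤ) (-2m≈μ : ι -2ℤ * m ≈ x + 1#) where

    private
      A : Matrix ℤ n
      A = adjacency G

      δ : Matrix Carrier n
      δ = identity n

      δ≈ : ∀ i j → ι (ℤΣ.identity n i j) ≈ δ i j
      δ≈ = identity-homo {ℤ-ring} {F} ι-homo

      μ : Carrier
      μ = x + 1#

    -- The Horner form, with its final `r * 0#`, is what `eval` produces from the coefficient list
    -- of an entry of I - tA; hence `K` matches `evalMatrix` definitionally.
    K : Matrix Carrier n
    K i j = ι (ℤΣ.identity n i j) + r * (ι (ℤ.- A i j) + r * 0#)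

    μK : ∀ i j → μ * K i j ≈ μ * δ i j + ι (+ 2) * ι (A i j)
    μK i j = begin
      μ * (ι (ℤΣ.identity n i j) + r * (ι (ℤ.- A i j) + r * 0#))
        ≈⟨ *-congˡ (+-cong (δ≈ i j) (*-congˡ (trans (+-congˡ (zeroʳ r)) (trans (+-identityʳ _) (ι-neg (A i j)))))) ⟩
      μ * (δ i j + r * - ι (A i j))
        ≈⟨ solve 4 (λ μ d r a → μ :* (d :+ r :* :- a) := μ :* d :+ (μ :* r) :* :- a) refl μ (δ i j) r (ι (A i j)) ⟩
      μ * δ i j + (μ * r) * - ι (A i j)
        ≈⟨ +-congˡ (*-congʳ μr≈-2) ⟩
      μ * δ i j + ι -2ℤ * - ι (A i j)
        ≈⟨ solve 2 (λ y a → y :+ con -2ℤ :* :- a := y :+ con (+ 2) :* a) refl (μ * δ i j) (ι (A i j)) ⟩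
      μ * δ i j + ι (+ 2) * ι (A i j) ∎

    seidel-entry : ∀ i j → x * δ i j + - ι (seidel G i j) ≈ μ * (K i j + u)
    seidel-entry i j = begin
      x * δ i j + - ι (seidel G i j)
        ≈⟨ +-congˡ (-‿cong (trans (ι-+ _ _) (+-cong
             (trans (ι-+ _ _) (+-cong ι-1 (trans (ι-neg _) (-‿cong (δ≈ i j)))))
             (trans (ι-neg _) (-‿cong (ι-* _ _)))))) ⟩
      x * δ i j + - (1# + - δ i j + - (ι (+ 2) * ι (A i j)))
        ≈⟨ solve 4 (λ x d a o → x :* d :+ :- (o :+ :- d :+ :- (con (+ 2) :* a)) := x :* d :+ d :+ con (+ 2) :* a :+ :- o)
             refl x (δ i j) (ι (A i j)) 1# ⟩
      x * δ i j + δ i j + ι (+ 2) * ι (A i j) + - 1#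
        ≈⟨ +-cong (+-congʳ (trans (+-congˡ (sym (*-identityˡ (δ i j)))) (sym (distribʳ (δ i j) x 1#))))
                  (trans (-‿cong (sym ι-1)) (trans (sym (ι-neg 1ℤ)) (sym μu≈-1))) ⟩
      μ * δ i j + ι (+ 2) * ι (A i j) + μ * u
        ≈⟨ +-congʳ (μK i j) ⟨
      μ * K i j + μ * u
        ≈⟨ distribˡ μ (K i j) u ⟨
      μ * (K i j + u) ∎

    adjacency-entry : ∀ i j → ι -2ℤ * (m * δ i j + - ι (A i j)) ≈ μ * K i j
    adjacency-entry i j = begin
      ι -2ℤ * (m * δ i j + - ι (A i j))
        ≈⟨ solve 3 (λ m d a → con -2ℤ :* (m :* d :+ :- a) := (con -2ℤ :* m) :* d :+ con (+ 2) :* a)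
             refl m (δ i j) (ι (A i j)) ⟩
      (ι -2ℤ * m) * δ i j + ι (+ 2) * ι (A i j)
        ≈⟨ +-congʳ (*-congʳ -2m≈μ) ⟩
      μ * δ i j + ι (+ 2) * ι (A i j)
        ≈⟨ μK i j ⟨
      μ * K i j ∎

    ι-^ : ∀ a k → ι (a ℤ.^ k) ≈ ι a ^ᶠ k
    ι-^ a ℕ.zero    = ι-1
    ι-^ a (ℕ.suc k) = trans (ι-* a (a ℤ.^ k)) (*-congˡ (ι-^ a k))

    characteristic-seidel : adjugateSum K ≈ h * det K →
      characteristic x (seidel G) ≈ ι (-2ℤ ℤ.^ n) * characteristic m A * (u * h + 1#)
    characteristic-seidel adj≈h*det = begin
      characteristic x (seidel G)
        ≈⟨ det-cong seidel-entry ⟩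
      det (λ i j → μ * (K i j + u))
        ≈⟨ det-scale μ (λ i j → K i j + u) ⟩
      μ ^ᶠ n * det (λ i j → K i j + u)
        ≈⟨ *-congˡ (trans (det-add-constant K u) (+-congˡ (*-congˡ adj≈h*det))) ⟩
      μ ^ᶠ n * (det K + u * (h * det K))
        -- In the solver `con 1ℤ` would denote `ι 1ℤ`; `1#` is passed as the variable `o` instead
        -- and must first be made visible before `det K`.
        ≈⟨ *-congˡ (+-congʳ (sym (*-identityˡ (det K)))) ⟩
      μ ^ᶠ n * (1# * det K + u * (h * det K))
        ≈⟨ solve 5 (λ p d u h o → p :* (o :* d :+ u :* (h :* d)) := p :* d :* (u :* h :+ o)) refl
             (μ ^ᶠ n) (det K) u h 1# ⟩
      μ ^ᶠ n * det K * (u * h + 1#)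
        -- The power of μ is not divided out: by μK = -2 (mI - A) it is traded for the power of -2.
        ≈⟨ *-congʳ (begin
             μ ^ᶠ n * det K                                             ≈⟨ det-scale μ K ⟨
             det (λ i j → μ * K i j)                                    ≈⟨ det-cong adjacency-entry ⟨
             det (λ i j → ι -2ℤ * (m * δ i j + - ι (A i j)))
               ≈⟨ det-scale (ι -2ℤ) (λ i j → m * δ i j + - ι (A i j)) ⟩
             ι -2ℤ ^ᶠ n * characteristic m A                        ≈⟨ *-congʳ (ι-^ -2ℤ n) ⟨
             ι (-2ℤ ℤ.^ n) * characteristic m A ∎) ⟩
      ι (-2ℤ ℤ.^ n) * characteristic m A * (u * h + 1#) ∎

-- The walk generating function

sum-identity : ∀ {n} (j : Fin n) (x : Fin n → ℤ) → ℤΣ.sum (λ i → ℤΣ.identity n i j ℤ.* x i) ≡ x j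
sum-identity {ℕ.suc n} 0F     x = ≡.trans
  (≡.cong₂ ℤ._+_ (ℤ.*-identityˡ (x 0F)) (sum-replicate-zero n)) (ℤ.+-identityʳ (x 0F))
sum-identity {ℕ.suc n} (1+ j) x = ≡.trans (ℤ.+-identityˡ _) (sum-identity j λ i → x (1+ i))

constant-⊛ : ∀ a (f : Series) k → (coeff (constᴾ a) ⊛ f) k ≡ a ℤ.* f k
constant-⊛ a f ℕ.zero    = ℤ.+-identityʳ _
constant-⊛ a f (ℕ.suc k) = ≡.trans (≡.cong (λ z → a ℤ.* f (ℕ.suc k) ℤ.+ z) (⊛-zeroˡ f k)) (ℤ.+-identityʳ _)

module ℤ⟦X⟧ where
  open CommutativeRing seriesRing public
  open Determinant seriesRing public

sum-series : ∀ {n} (w : Fin n → Series) k → ℤ⟦X⟧.sum w k ≡ ℤΣ.sum (λ i → w i k)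
sum-series {ℕ.zero}  w k = ≡.refl
sum-series {ℕ.suc n} w k = ≡.cong (λ z → w 0F k ℤ.+ z) (sum-series (λ i → w (1+ i)) k)

module _ {n} (G : Hypergraph n) where
  private
    module ℤXΔ = Determinant polyRing

  I-tA : Matrix Poly n
  I-tA i j = ℤΣ.identity n i j ∷ (ℤ.- adjacency G i j) ∷ []

  walkDen walkNum : Poly
  walkDen = ℤXΔ.det I-tA
  walkNum = ℤXΔ.adjugateSum I-tA

  -- At t = 0 the matrix I - tA becomes the identity, so the constant term of `walkDen` is 1.
  walkDen-nonzero : ¬ walkDen ≈ᴾ 0ᴾ
  walkDen-nonzero D≈0 = 1≢0 (≡.trans (≡.sym value) (⟪⟫-cong walkDen 0ᴾ D≈0))
    where
    open Horner ℤ-ring (λ a → a) id-homo 0ℤ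
    value : ⟪ walkDen ⟫ ≡ 1ℤ
    value = ≡.trans (det-homo {polyRing} {ℤ-ring} ⟪⟫-homo I-tA)
      (≡.trans (ℤΣ.det-cong λ i j → ℤ.+-identityʳ (ℤΣ.identity n i j)) (ℤΣ.det-identity n))
    1≢0 : 1ℤ ≢ 0ℤ
    1≢0 ()

  -- Coefficient 0 counts the single walk of length 0 from j; coefficient k+1 is the entry at j of
  -- wₖ₊₁ - wₖA, which vanishes by `walksFrom-suc`.
  walksFrom-resolvent : ∀ j → ℤ⟦X⟧.sum (λ i → (λ l → walksFrom G l i) ⊛ coeff (I-tA i j)) ℤ⟦X⟧.≈ coeff 1ᴾ
  walksFrom-resolvent j k = ≡.trans (sum-series (λ i → (λ l → walksFrom G l i) ⊛ coeff (I-tA i j)) k)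
    -- With the polynomial as first factor the convolution unfolds along its two coefficients.
    (≡.trans (sum-cong-≗ λ i → ⊛-comm (λ l → walksFrom G l i) (coeff (I-tA i j)) k) (coefficient k))
    where
    coefficient : ∀ k → ℤΣ.sum (λ i → (coeff (I-tA i j) ⊛ λ l → walksFrom G l i) k) ≡ coeff 1ᴾ k
    coefficient ℕ.zero = ≡.trans
      (sum-cong-≗ λ i → ℤ.+-identityʳ (ℤΣ.identity n i j ℤ.* walksFrom G 0 i))
      (sum-identity j (walksFrom G 0))
    coefficient (ℕ.suc k) = begin
      ℤΣ.sum (λ i → ℤΣ.identity n i j ℤ.* walksFrom G (ℕ.suc k) i ℤ.+
                    (coeff (constᴾ (ℤ.- adjacency G i j)) ⊛ λ l → walksFrom G l i) k)
        ≡⟨ ∑-distrib-+ (λ i → ℤΣ.identity n i j ℤ.* walksFrom G (ℕ.suc k) i) _ ⟩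
      ℤΣ.sum (λ i → ℤΣ.identity n i j ℤ.* walksFrom G (ℕ.suc k) i) ℤ.+
      ℤΣ.sum (λ i → (coeff (constᴾ (ℤ.- adjacency G i j)) ⊛ λ l → walksFrom G l i) k)
        ≡⟨ ≡.cong₂ ℤ._+_ (sum-identity j (walksFrom G (ℕ.suc k))) (≡.trans
             (sum-cong-≗ λ i → ≡.trans (constant-⊛ (ℤ.- adjacency G i j) (λ l → walksFrom G l i) k) (negate i))
             (≡.sym (*-distribˡ-sum -1ℤ λ i → walksFrom G k i ℤ.* adjacency G i j))) ⟩
      walksFrom G (ℕ.suc k) j ℤ.+ -1ℤ ℤ.* ℤΣ.sum (λ i → walksFrom G k i ℤ.* adjacency G i j)
        ≡⟨ ≡.cong₂ (λ x y → x ℤ.+ y) (walksFrom-suc G k j) (ℤ.-1*i≡-i _) ⟩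
      ℤΣ.sum (λ i → walksFrom G k i ℤ.* adjacency G i j) ℤ.- ℤΣ.sum (λ i → walksFrom G k i ℤ.* adjacency G i j)
        ≡⟨ ℤ.+-inverseʳ (ℤΣ.sum (λ i → walksFrom G k i ℤ.* adjacency G i j)) ⟩
      0ℤ ∎
      where
      open ≡.≡-Reasoning
      negate : ∀ i → ℤ.- adjacency G i j ℤ.* walksFrom G k i ≡ -1ℤ ℤ.* (walksFrom G k i ℤ.* adjacency G i j)
      negate i = ≡.trans (≡.sym (ℤ.neg-distribˡ-* (adjacency G i j) (walksFrom G k i)))
        (≡.trans (≡.cong ℤ.-_ (ℤ.*-comm (adjacency G i j) (walksFrom G k i))) (≡.sym (ℤ.-1*i≡-i _)))

  walkDen-walkSeries : coeff walkDen ⊛ walkSeries G ℤ⟦X⟧.≈ coeff walkNum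
  walkDen-walkSeries = ℤ⟦X⟧.sym (begin
    coeff walkNum
      ≈⟨ adjugateSum-homo {polyRing} {seriesRing} coeff-homo I-tA ⟩
    ℤ⟦X⟧.adjugateSum (λ i j → coeff (I-tA i j))
      ≈⟨ ℤ⟦X⟧.adjugateSum-resolvent (λ i j → coeff (I-tA i j)) (λ i l → walksFrom G l i) walksFrom-resolvent ⟩
    ℤ⟦X⟧.sum (λ i l → walksFrom G l i) ⊛ ℤ⟦X⟧.det (λ i j → coeff (I-tA i j))
      ≈⟨ ⊛-cong (λ l → ≡.trans (sum-series (λ i l → walksFrom G l i) l) (≡.sym (walkSeries-sum G l)))
                (ℤ⟦X⟧.sym (det-homo {polyRing} {seriesRing} coeff-homo I-tA)) ⟩
    walkSeries G ⊛ coeff walkDen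
      ≈⟨ ⊛-comm (walkSeries G) (coeff walkDen) ⟩
    coeff walkDen ⊛ walkSeries G ∎)
    where open import Relation.Binary.Reasoning.Setoid ℤ⟦X⟧.setoid

-- Substitution of -2/(λ+1)

module _ (F : CommutativeRing 0ℓ 0ℓ) where
  open CommutativeRing F
  open import Algebra.Solver.Ring.NaturalCoefficients.Default commutativeSemiring
    using (solve; _:+_; _:*_; _:=_)

  -- The forms p/d and N/D are compared through the series s that both represent.
  cross-multiply : ∀ {d p D N s} → D * s ≈ N → d * s ≈ p → d * N ≈ p * D
  cross-multiply {d} {p} {D} {N} {s} Ds≈N ds≈p = trans (*-congˡ (sym Ds≈N))
    (trans (solve 3 (λ d D s → d :* (D :* s) := (d :* s) :* D) refl d D s) (*-congʳ ds≈p))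

  -- The common factor d is left in place, to be cancelled where its value is known to be nonzero.
  quotient : ∀ {d p D N h} → d * N ≈ p * D → h * d ≈ p → N * d ≈ (h * D) * d
  quotient {d} {p} {D} {N} {h} dN≈pD hd≈p = trans (*-comm N d) (trans dN≈pD
    (trans (*-congʳ (sym hd≈p)) (solve 3 (λ h d D → (h :* d) :* D := (h :* D) :* d) refl h d D)))

open Characteristic ratFunRing Defs.const const-homo
module ℚXΔ = Determinant ratFunRing

λ+1 : RatFun
λ+1 = fromPoly Xᴾ +ᴿ 1ᴿ

-- Cross-multiplied, both sides are concrete polynomials of degree 1: two coefficients are compared
-- by computation, and beyond them both lists are exhausted. The next two identities hold likewise.
⟨λ+1⟩*-1/⟨λ+1⟩ : λ+1 *ᴿ -1/⟨λ+1⟩ ℚX.≈ Defs.const -1ℤ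
⟨λ+1⟩*-1/⟨λ+1⟩ = λ { 0 → ≡.refl ; 1 → ≡.refl ; (ℕ.suc (ℕ.suc k)) → ≡.refl }

⟨λ+1⟩*-2/⟨λ+1⟩ : λ+1 *ᴿ -2/⟨λ+1⟩ ℚX.≈ Defs.const -2ℤ
⟨λ+1⟩*-2/⟨λ+1⟩ = λ { 0 → ≡.refl ; 1 → ≡.refl ; (ℕ.suc (ℕ.suc k)) → ≡.refl }

-2*-⟨λ+1⟩/2 : Defs.const -2ℤ *ᴿ -⟨λ+1⟩/2 ℚX.≈ λ+1
-2*-⟨λ+1⟩/2 = λ { 0 → ≡.refl ; 1 → ≡.refl ; (ℕ.suc (ℕ.suc k)) → ≡.refl }

module _ {n} (G : Hypergraph n) (H : RatFun) (form : IsRationalFormOf H (walkSeries G)) where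
  private
    r : RatFun
    r = -2/⟨λ+1⟩
    φ : Poly → RatFun
    φ p = eval p r
    φ-homo : IsRingHomomorphism polyRawRing ratFunRawRing φ
    φ-homo = eval-homo r
    module φ = IsRingHomomorphism φ-homo

  definedAt : DefinedAt H r
  definedAt = eval-nonzero (den H) (den≉0 H)

  private
    h : RatFun
    h = substitute H r definedAt
    D N d p : RatFun
    D = φ (walkDen G)
    N = φ (walkNum G)
    d = φ (den H)
    p = φ (num H)

  cross : den H *ᴾ walkNum G ≈ᴾ num H *ᴾ walkDen G
  cross = ℤ⟦X⟧.trans (coeff-*ᴾ (den H) (walkNum G)) (ℤ⟦X⟧.trans
    (cross-multiply seriesRing {coeff (den H)} {coeff (num H)} {coeff (walkDen G)} {coeff (walkNum G)} {walkSeries G}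
      (walkDen-walkSeries G) form)
    (ℤ⟦X⟧.sym (coeff-*ᴾ (num H) (walkDen G))))

  adjugateSum-det : N ℚX.≈ h *ᴿ D
  adjugateSum-det = *ᴿ-cancelʳ N (h *ᴿ D) d definedAt
    (quotient ratFunRing {d} {p} {D} {N} {h} dN≈pD (divide-cancel p d definedAt))
    where
    open import Relation.Binary.Reasoning.Setoid ℚX.setoid
    dN≈pD : d *ᴿ N ℚX.≈ p *ᴿ D
    dN≈pD = begin
      d *ᴿ N                      ≈⟨ φ.*-homo (den H) (walkNum G) ⟨
      φ (den H *ᴾ walkNum G)      ≈⟨ φ.⟦⟧-cong {den H *ᴾ walkNum G} {num H *ᴾ walkDen G} cross ⟩
      φ (num H *ᴾ walkDen G)      ≈⟨ φ.*-homo (num H) (walkDen G) ⟩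
      p *ᴿ D                      ∎

  open import Relation.Binary.Reasoning.Setoid ℚX.setoid

  evalMatrix : Matrix RatFun n
  evalMatrix i j = φ (I-tA G i j)

  adjugateSum-evalMatrix : ℚXΔ.adjugateSum evalMatrix ℚX.≈ h *ᴿ ℚXΔ.det evalMatrix
  adjugateSum-evalMatrix = begin
    ℚXΔ.adjugateSum evalMatrix   ≈⟨ adjugateSum-homo {polyRing} {ratFunRing} φ-homo (I-tA G) ⟨
    N                            ≈⟨ adjugateSum-det ⟩
    h *ᴿ D                       ≈⟨ ℚX.*-congˡ {h} {D} {ℚXΔ.det evalMatrix} (det-homo {polyRing} {ratFunRing} φ-homo (I-tA G)) ⟩
    h *ᴿ ℚXΔ.det evalMatrix      ∎

  charPoly-adjacency : characteristic -⟨λ+1⟩/2 (adjacency G) ℚX.≈ eval (charPoly (adjacency G)) -⟨λ+1⟩/2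
  charPoly-adjacency = begin
    characteristic -⟨λ+1⟩/2 (adjacency G)
      ≈⟨ characteristic-cong {eval Xᴾ -⟨λ+1⟩/2} { -⟨λ+1⟩/2} ⟪Xᴾ⟫ (adjacency G) ⟨
    characteristic (eval Xᴾ -⟨λ+1⟩/2) (adjacency G)
      ≈⟨ charPoly-homo (eval-homo -⟨λ+1⟩/2) ⟪constᴾ⟫ (adjacency G) ⟨
    eval (charPoly (adjacency G)) -⟨λ+1⟩/2 ∎
    where open Horner ratFunRing Defs.const const-homo -⟨λ+1⟩/2 using (⟪Xᴾ⟫; ⟪constᴾ⟫)

  charPoly-seidel : fromPoly (charPoly (seidel G)) ℚX.≈
    Defs.const (-2ℤ ℤ.^ n) *ᴿ eval (charPoly (adjacency G)) -⟨λ+1⟩/2 *ᴿ (-1/⟨λ+1⟩ *ᴿ h +ᴿ 1ᴿ)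
  charPoly-seidel = begin
    fromPoly (charPoly (seidel G))
      ≈⟨ charPoly-homo fromPoly-homo (λ a → ℚX.refl {Defs.const a}) (seidel G) ⟩
    characteristic (fromPoly Xᴾ) (seidel G)
      ≈⟨ characteristic-seidel G {fromPoly Xᴾ} { -1/⟨λ+1⟩} {r} { -⟨λ+1⟩/2} {h}
           ⟨λ+1⟩*-1/⟨λ+1⟩ ⟨λ+1⟩*-2/⟨λ+1⟩ -2*-⟨λ+1⟩/2 adjugateSum-evalMatrix ⟩
    c *ᴿ characteristic -⟨λ+1⟩/2 (adjacency G) *ᴿ e
      ≈⟨ ℚX.*-congʳ {e} {c *ᴿ characteristic -⟨λ+1⟩/2 (adjacency G)} {c *ᴿ eval (charPoly (adjacency G)) -⟨λ+1⟩/2}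
           (ℚX.*-congˡ {c} {characteristic -⟨λ+1⟩/2 (adjacency G)} {eval (charPoly (adjacency G)) -⟨λ+1⟩/2} charPoly-adjacency) ⟩
    c *ᴿ eval (charPoly (adjacency G)) -⟨λ+1⟩/2 *ᴿ e ∎
    where
    c e : RatFun
    c = Defs.const (-2ℤ ℤ.^ n)
    e = -1/⟨λ+1⟩ *ᴿ h +ᴿ 1ᴿ

open Defs using (_≈_; const)
open import Data.Integer.Base using (-_; _^_)

theorem3p1 : (n : ℕ) (G : Hypergraph n) →
    (∃ λ (H : RatFun) → IsRationalFormOf H (walkSeries G))
    × ((H : RatFun) → IsRationalFormOf H (walkSeries G) →
    Σ (DefinedAt H -2/⟨λ+1⟩) λ d →
    fromPoly (charPoly (seidel G))
    ≈ const ((- (+ 2)) ^ n)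
    *ᴿ eval (charPoly (adjacency G)) -⟨λ+1⟩/2
    *ᴿ (-1/⟨λ+1⟩ *ᴿ substitute H -2/⟨λ+1⟩ d +ᴿ 1ᴿ))
-- The quotient N/D is itself a rational form of the walk series, so the claim about all forms is
-- not vacuous.
theorem3p1 n G = (walkNum G /ᴾ walkDen G ⟨ walkDen-nonzero G ⟩ , walkDen-walkSeries G) ,
  λ H form → definedAt G H form , charPoly-seidel G H form
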